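{- Let $k \geq 3$ be a fixed integer, let $\mathcal{H}$ be a family of graphs, and let $g := g(\mathcal{H},k)$. For each $n$ let $G$ be an $\mathcal{H}$-free $n$-vertex graph with maximum degree $\Delta := \Delta(n)$. If $m = m(n)$ satisfies $m \gg n^{2/(k (g+1))} \Delta^{2 g/(k (g+1))}$ and $m \geq 3 k^2 \Delta$, then $G$ is a.a.s. $(k,m)$-colourable.
   Context: A graph is $\mathcal{H}$-free if no $H \in \mathcal{H}$ is a (not necessarily induced) subgraph of it. A graph is $k$-choosable if it admits a proper colouring from the lists for every assignment of lists of size $k$ to its vertices. $g(\mathcal{H},k)$ is the largest integer $g$ such that every $\mathcal{H}$-free graph on at most $g$ vertices is $k$-choosable. A random $(k,m)$-list-assignment $\mathcal{L} = \{L(v): v\in V(G)\}$ assigns to each vertex independently a uniformly random $k$-subset of $\{1,\ldots,m\}$; $G$ is $\mathcal{L}$-colourable if there is a proper colouring $c$ with $c(v)\in L(v)$ for all $v$. $G$ is a.a.s. $(k,m)$-colourable if $\mathbb{P}(G \text{ is } \mathcal{L}\text{ -colourable}) \to 1$ as $n \to \infty$. The notation $m \gg f$ means $m/f \to \infty$ as $n\to\infty$. -}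

module Defs where

open import Data.Nat using (ℕ; zero; suc; _+_; _*_; _^_; _≤_; _<_)
open import Data.Bool using (Bool; true; false; _∧_; not; if_then_else_)
open import Data.Fin using (Fin)
open import Data.Fin.Subset using (Subset; _∈_; ∣_∣)
open import Data.Vec using (Vec; []; _∷_; lookup)
open import Data.List using (List; []; _∷_; map; concatMap; filter; length; allFin)
open import Data.Bool.ListAction using (all; any)
open import Data.Product using (Σ; _×_; _,_; ∃-syntax)
open import Relation.Binary.PropositionalEquality using (_≡_; _≢_)
open import Relation.Nullary using (¬_)
open import Function.Definitions using (Injective)
import Data.Nat as ℕ

record Graph (n : ℕ) : Set where
  field
    adj  : Fin n → Fin n → Bool
    sym  : ∀ u v → adj u v ≡ adj v u
    irr  : ∀ v → adj v v ≡ false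
open Graph public

_⊆G_ : ∀ {a b} → Graph a → Graph b → Set
_⊆G_ {a} {b} H G = Σ (Fin a → Fin b) λ f →
  Injective _≡_ _≡_ f × (∀ u v → adj H u v ≡ true → adj G (f u) (f v) ≡ true)

Family : Set₁
Family = ∀ {a} → Graph a → Set

_-free : ∀ {n} → Family → Graph n → Set
_-free {n} ℋ G = ∀ {a} (H : Graph a) → ℋ H → ¬ (H ⊆G G)

ListAssignment : ℕ → ℕ → Set
ListAssignment n m = Fin n → Subset m

ProperFrom : ∀ {n m} → Graph n → ListAssignment n m → (Fin n → Fin m) → Set
ProperFrom G L c = (∀ v → c v ∈ L v) × (∀ u v → adj G u v ≡ true → c u ≢ c v)

Colourable : ∀ {n m} → Graph n → ListAssignment n m → Set
Colourable G L = ∃[ c ] ProperFrom G L c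

-- k-choosable: colourable from every assignment of lists of size k (colours from ℕ;
-- any finite family of lists uses finitely many colours, so colours drawn from Fin m for every m)
Choosable : ∀ {n} → ℕ → Graph n → Set
Choosable {n} k G = ∀ m (L : ListAssignment n m) → (∀ v → ∣ L v ∣ ≡ k) → Colourable G L

IsG : Family → ℕ → ℕ → Set
IsG ℋ k g = (∀ {n} (G : Graph n) → n ≤ g → (ℋ -free) G → Choosable k G)
          × ¬ (∀ {n} (G : Graph n) → n ≤ suc g → (ℋ -free) G → Choosable k G)

degree : ∀ {n} → Graph n → Fin n → ℕ
degree G v = length (filter (λ u → Data.Bool._≟_ (adj G v u) true) (allFin _))
  where import Data.Bool

MaxDegree : ∀ {n} → Graph n → ℕ → Set
MaxDegree G Δ = (∀ v → degree G v ≤ Δ) × (Δ ≡ 0 ⊎' ∃[ v ] degree G v ≡ Δ)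
  where
  open import Data.Sum renaming (_⊎_ to _⊎'_)

allVecs : ∀ m → List (Vec Bool m)
allVecs zero    = [] ∷ []
allVecs (suc m) = concatMap (λ v → (true ∷ v) ∷ (false ∷ v) ∷ []) (allVecs m)

kSubsets : ℕ → (m : ℕ) → List (Subset m)
kSubsets k m = filter (λ s → ∣ s ∣ ℕ.≟ k) (allVecs m)

allAssignments : ℕ → (n m : ℕ) → List (Vec (Subset m) n)
allAssignments k zero    m = [] ∷ []
allAssignments k (suc n) m =
  concatMap (λ s → map (s ∷_) (allAssignments k n m)) (kSubsets k m)

-- Number of (k,m)-list-assignments (each equally likely under the uniform model)
-- from which G is NOT colourable.  Colourability of a finite instance is decidable;
-- we use the propositional notion via a decision procedure supplied below.
open import Relation.Nullary using (Dec; yes; no)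
open import Relation.Nullary.Decidable using (⌊_⌋)

private
  allMaps : (n m : ℕ) → List (Vec (Fin m) n)
  allMaps zero    m = [] ∷ []
  allMaps (suc n) m = concatMap (λ c → map (c ∷_) (allMaps n m)) (allFin m)

  okB : ∀ {n m} → Graph n → Vec (Subset m) n → Vec (Fin m) n → Bool
  okB {n} G L c =
    all (λ v → Data.Bool._∧_ (lookup (lookup L v) (lookup c v))
       (all (λ u → not (adj G v u) Data.Bool.∨
                   not ⌊ Data.Fin._≟_ (lookup c v) (lookup c u) ⌋) (allFin n)))
        (allFin n)
    where import Data.Bool ; import Data.Fin

colourableB : ∀ {n m} → Graph n → Vec (Subset m) n → Bool
colourableB {n} {m} G L = any (okB G L) (allMaps n m)

badCount : ∀ {n} → ℕ → ℕ → Graph n → ℕ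
badCount {n} k m G =
  length (filter (λ L → Data.Bool._≟_ (colourableB G L) false) (allAssignments k n m))
  where import Data.Bool

totalCount : ℕ → ℕ → ℕ → ℕ
totalCount k n m = length (allAssignments k n m)

{-# OPTIONS --safe --termination-depth=2 #-}
module Submission where

-- Call a conflict an edge of G whose two lists meet. A conflict has probability at most
-- k²/m ≤ 1/(3Δ), while an r-vertex exploration from a given vertex can be done in at most (eΔ)^r
-- ways; since e < 3, a.a.s. all components of conflicts have O(log n) vertices. Colours never
-- clash across components, and a vertex with a colour absent from its neighbours' lists can be
-- coloured last, so a non-colourable G contains a connected set of s = O(log n) vertices in which
-- every colour lies in at least two lists; s > g because smaller subgraphs are k-choosable. At
-- most ks/2 colours then occur on this set, which has probability s^O(s) m^(-ks/2), against
-- n(sΔ)^(s-1) sets. The hypothesis m ≫ n^(2/(k(g+1))) Δ^(2g/(k(g+1))) makes this small for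
-- s = g + 1, and k ≥ 3 with m ≥ 3k²Δ makes the sum over larger s geometric.

open import Defs hiding (sym)
open import Data.Bool using (Bool; true; false; _∧_; _∨_; not; if_then_else_)
import Data.Bool as Bool
open import Data.Bool.ListAction using (any; all)
open import Data.Bool.Properties using (∧-comm; ∧-identityʳ; ∧-zeroʳ; ∨-zeroʳ)
open import Data.Fin using (Fin; zero; suc)
import Data.Fin as Fin
import Data.Fin.Properties as Fin
open import Data.Fin.Subset using (Subset; ∣_∣)
open import Data.Fin.Subset.Properties using (∣p∣≤n)
open import Data.List using (List; []; _∷_; _++_; map; concatMap; filter; length; allFin; applyUpTo; upTo; [_])
import Data.List as List
open import Data.List.Membership.Propositional using (_∈_; _∉_; find; lose)
open import Data.List.Membership.Propositional.Properties using (∈-concatMap⁺; ∈-concatMap⁻; ∈-map⁺; ∈-map⁻; ∈-filter⁺; ∈-filter⁻; ∈-allFin; ∈-++⁺ˡ; ∈-++⁺ʳ; ∈-lookup; ∈-length; ∈-upTo⁺)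
open import Data.List.Properties using (map-tabulate; length-map; length-++; length-filter; length-tabulate; filter-notAll)
open import Data.List.Relation.Unary.All using (All; []; _∷_)
import Data.List.Relation.Unary.All as All
open import Data.List.Relation.Unary.All.Properties using (++⁺; map⁺; ¬Any⇒All¬; All¬⇒¬Any)
open import Data.List.Relation.Unary.AllPairs using ([]; _∷_)
open import Data.List.Relation.Unary.Any using (here; there; index)
import Data.List.Relation.Unary.Any as Any
open import Data.List.Relation.Unary.Any.Properties using (lookup-index)
open import Data.List.Relation.Unary.Unique.Propositional using (Unique)
open import Data.Nat
open import Data.Nat.Combinatorics using (nC1≡n; nCk+nC[k+1]≡[n+1]C[k+1]) renaming (_C_ to _binom_)
open import Data.Nat.Properties
open import Algebra.Properties.CommutativeSemigroup +-commutativeSemigroup using () renaming (interchange to +-interchange)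
open import Algebra.Properties.CommutativeSemigroup *-commutativeSemigroup using (x∙yz≈y∙xz; xy∙z≈xz∙y; interchange)
open import Data.Nat.Tactic.RingSolver using (solve-∀)
open import Data.Product using (Σ; _×_; _,_; proj₁; proj₂; ∃-syntax)
open import Data.Sum using (_⊎_; inj₁; inj₂; [_,_]′)
open import Data.Vec using (Vec; []; _∷_; lookup; tabulate; _[_]≔_)
open import Data.Vec.Properties using (lookup∘tabulate; lookup∘update; lookup∘update′; []=⇒lookup)
open import Function using (_∘_; id)
open import Level using (0ℓ)
open import Relation.Binary.PropositionalEquality using (_≡_; _≢_; refl; sym; trans; cong; cong₂; subst; module ≡-Reasoning)
open import Relation.Nullary using (yes; no; does; ¬?; ¬_; _×-dec_; contradiction)
open import Relation.Nullary.Decidable using (⌊_⌋)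
open import Relation.Unary using (Decidable; Pred)

-- Probabilities are never formed: estimates are inequalities between natural numbers with the
-- denominators multiplied out, and independence enters only by redrawing a single list. The
-- obstacle in the exploration is dependence. A successful test reveals the lists of found vertices
-- only, but a failed test says something about a vertex not yet found. Hence failures are not
-- recorded: each test is bounded by the sum of "ignore it" and "it succeeds". With N = (r+1)Δ as
-- the budget of tests, the bound reached is 3^(-r) (1 + 1/Δ)^N, which dominates C(N,r) (3Δ)^(-r).
-- Since (1 + 1/Δ)^Δ ≤ 29/10, it decays like (29/30)^r. The logarithmic size of components is needed
-- in the second half: each vertex beyond g + 1 costs a factor s^O(1), while `m` is only known to
-- exceed a fixed power of n. A polylogarithmic s makes that factor at most `m`.

private variable
  A B : Set
  n m : ℕ

-- Indicators and finite sums

⟦_⟧ : Bool → ℕ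
⟦ b ⟧ = if b then 1 else 0

⟦⟧≤1 : ∀ b → ⟦ b ⟧ ≤ 1
⟦⟧≤1 false = z≤n
⟦⟧≤1 true  = ≤-refl

⟦∧⟧ : ∀ a b → ⟦ a ∧ b ⟧ ≡ ⟦ a ⟧ * ⟦ b ⟧
⟦∧⟧ false b = refl
⟦∧⟧ true  b = sym (*-identityˡ ⟦ b ⟧)

any-true : (p : A → Bool) {x : A} {xs : List A} → x ∈ xs → p x ≡ true → any p xs ≡ true
any-true p {x} (here refl) px rewrite px = refl
any-true p {xs = y ∷ _} (there x∈xs) px rewrite any-true p x∈xs px = ∨-zeroʳ (p y)

∑ : List A → (A → ℕ) → ℕ
∑ []       f = 0
∑ (x ∷ xs) f = f x + ∑ xs f

syntax ∑ xs (λ x → e) = ∑[ x ∈ xs ] e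
infixr 8 ∑

∑-cong : ∀ {f g : A → ℕ} → (∀ x → f x ≡ g x) → ∀ xs → ∑ xs f ≡ ∑ xs g
∑-cong f≗g []       = refl
∑-cong f≗g (x ∷ xs) = cong₂ _+_ (f≗g x) (∑-cong f≗g xs)

∑-mono-∈ : ∀ {f g : A → ℕ} (xs : List A) → (∀ {x} → x ∈ xs → f x ≤ g x) → ∑ xs f ≤ ∑ xs g
∑-mono-∈ []       f≤g = z≤n
∑-mono-∈ (x ∷ xs) f≤g = +-mono-≤ (f≤g (here refl)) (∑-mono-∈ xs (f≤g ∘ there))

∑-mono : ∀ {f g : A → ℕ} (xs : List A) → (∀ x → f x ≤ g x) → ∑ xs f ≤ ∑ xs g
∑-mono xs f≤g = ∑-mono-∈ xs (λ {x} _ → f≤g x)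

∑-++ : ∀ (f : A → ℕ) xs ys → ∑ (xs ++ ys) f ≡ ∑ xs f + ∑ ys f
∑-++ f []       ys = refl
∑-++ f (x ∷ xs) ys = trans (cong (f x +_) (∑-++ f xs ys)) (sym (+-assoc (f x) _ _))

∑-map : ∀ (f : B → ℕ) (h : A → B) xs → ∑ (map h xs) f ≡ ∑ xs (f ∘ h)
∑-map f h []       = refl
∑-map f h (x ∷ xs) = cong (f (h x) +_) (∑-map f h xs)

∑-concatMap : ∀ (f : B → ℕ) (h : A → List B) xs → ∑ (concatMap h xs) f ≡ ∑[ x ∈ xs ] ∑ (h x) f
∑-concatMap f h []       = refl
∑-concatMap f h (x ∷ xs) = trans (∑-++ f (h x) _) (cong (∑ (h x) f +_) (∑-concatMap f h xs))

∑-+ : ∀ (f g : A → ℕ) xs → ∑[ x ∈ xs ] (f x + g x) ≡ ∑ xs f + ∑ xs g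
∑-+ f g []       = refl
∑-+ f g (x ∷ xs) = trans (cong (f x + g x +_) (∑-+ f g xs)) (+-interchange (f x) (g x) _ _)

∑-*ˡ : ∀ c (f : A → ℕ) xs → ∑[ x ∈ xs ] (c * f x) ≡ c * ∑ xs f
∑-*ˡ c f []       = sym (*-zeroʳ c)
∑-*ˡ c f (x ∷ xs) = trans (cong (c * f x +_) (∑-*ˡ c f xs)) (sym (*-distribˡ-+ c (f x) _))

∑-const : ∀ c (xs : List A) → ∑[ x ∈ xs ] c ≡ length xs * c
∑-const c []       = refl
∑-const c (x ∷ xs) = cong (c +_) (∑-const c xs)

∑-zero : ∀ (xs : List A) → ∑[ x ∈ xs ] 0 ≡ 0
∑-zero []       = refl
∑-zero (x ∷ xs) = ∑-zero xs

∑-swap : ∀ (f : A → B → ℕ) xs ys → ∑[ x ∈ xs ] ∑[ y ∈ ys ] f x y ≡ ∑[ y ∈ ys ] ∑[ x ∈ xs ] f x y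
∑-swap f []       ys = sym (∑-zero ys)
∑-swap f (x ∷ xs) ys =
  trans (cong (∑ ys (f x) +_) (∑-swap f xs ys)) (sym (∑-+ (f x) _ ys))

∑-≤length : ∀ {f : A → ℕ} {c} (xs : List A) → (∀ {x} → x ∈ xs → f x ≤ c) → ∑ xs f ≤ length xs * c
∑-≤length xs f≤c = ≤-trans (∑-mono-∈ xs f≤c) (≤-reflexive (∑-const _ xs))

f≤∑ : ∀ (f : A → ℕ) {x xs} → x ∈ xs → f x ≤ ∑ xs f
f≤∑ f (here refl) = m≤m+n (f _) _
f≤∑ f {xs = y ∷ _} (there x∈xs) = ≤-trans (f≤∑ f x∈xs) (m≤n+m _ (f y))

2≤∑ : ∀ (f : A → ℕ) {x y xs} → x ∈ xs → y ∈ xs → x ≢ y → 1 ≤ f x → 1 ≤ f y → 2 ≤ ∑ xs f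
2≤∑ f (here refl)  (here refl)  x≢y _  _  = contradiction refl x≢y
2≤∑ f (here refl)  (there y∈xs) _   fx fy = +-mono-≤ fx (≤-trans fy (f≤∑ f y∈xs))
2≤∑ f (there x∈xs) (here refl)  _   fx fy = +-mono-≤ fy (≤-trans fx (f≤∑ f x∈xs))
2≤∑ f (there x∈xs) (there y∈xs) x≢y fx fy = ≤-trans (2≤∑ f x∈xs y∈xs x≢y fx fy) (m≤n+m _ _)

⟦any⟧≤∑ : ∀ (p : A → Bool) xs → ⟦ any p xs ⟧ ≤ ∑[ x ∈ xs ] ⟦ p x ⟧
⟦any⟧≤∑ p []       = z≤n
⟦any⟧≤∑ p (x ∷ xs) with p x
... | true  = s≤s z≤n
... | false = ⟦any⟧≤∑ p xs

∑-filter : ∀ {P : Pred A 0ℓ} (P? : Decidable P) (f : A → ℕ) xs →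
  ∑ (filter P? xs) f ≡ ∑[ x ∈ xs ] (⟦ does (P? x) ⟧ * f x)
∑-filter P? f []       = refl
∑-filter P? f (x ∷ xs) with does (P? x)
... | true  = cong₂ _+_ (sym (*-identityˡ (f x))) (∑-filter P? f xs)
... | false = ∑-filter P? f xs

length≡∑ : (xs : List A) → length xs ≡ ∑[ x ∈ xs ] 1
length≡∑ xs = sym (trans (∑-const 1 xs) (*-identityʳ _))

length-concatMap : ∀ {c} (h : A → List B) xs → (∀ {x} → x ∈ xs → length (h x) ≤ c) →
  length (concatMap h xs) ≤ length xs * c
length-concatMap {c = c} h xs h≤c = begin
  length (concatMap h xs)        ≡⟨ length≡∑ (concatMap h xs) ⟩
  ∑ (concatMap h xs) (λ _ → 1)   ≡⟨ ∑-concatMap _ h xs ⟩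
  ∑ xs (λ x → ∑ (h x) (λ _ → 1)) ≡⟨ ∑-cong (λ x → sym (length≡∑ (h x))) xs ⟩
  ∑ xs (length ∘ h)              ≤⟨ ∑-≤length xs h≤c ⟩
  length xs * c                  ∎
  where open ≤-Reasoning

∑-allFin : ∀ {n} (f : Fin (suc n) → ℕ) → ∑ (allFin (suc n)) f ≡ f zero + ∑ (allFin n) (f ∘ suc)
∑-allFin f = cong (f zero +_) (trans (cong (λ xs → ∑ xs f) (sym (map-tabulate id suc))) (∑-map f suc (allFin _)))

-- Counting k-subsets

card≡∑ : ∀ {m} (s : Subset m) → ∣ s ∣ ≡ ∑[ c ∈ allFin m ] ⟦ lookup s c ⟧
card≡∑ []          = refl
card≡∑ (true ∷ s)  = trans (cong suc (card≡∑ s)) (sym (∑-allFin (λ c → ⟦ lookup (true ∷ s) c ⟧)))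
card≡∑ (false ∷ s) = trans (card≡∑ s) (sym (∑-allFin (λ c → ⟦ lookup (false ∷ s) c ⟧)))

∑-allVecs : ∀ m (f : Subset (suc m) → ℕ) →
  ∑ (allVecs (suc m)) f ≡ ∑[ s ∈ allVecs m ] f (true ∷ s) + ∑[ s ∈ allVecs m ] f (false ∷ s)
∑-allVecs m f = trans (∑-concatMap f _ (allVecs m))
  (trans (∑-cong (λ s → cong (f (true ∷ s) +_) (+-identityʳ _)) (allVecs m)) (∑-+ _ _ (allVecs m)))

∑-kSubsets-zero : ∀ m (f : Subset (suc m) → ℕ) →
  ∑ (kSubsets 0 (suc m)) f ≡ ∑[ s ∈ kSubsets 0 m ] f (false ∷ s)
∑-kSubsets-zero m f = trans (∑-filter _ f (allVecs (suc m)))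
  (trans (∑-allVecs m _)
  (cong₂ _+_ (∑-zero (allVecs m)) (sym (∑-filter _ (λ s → f (false ∷ s)) (allVecs m)))))

∑-kSubsets-suc : ∀ k m (f : Subset (suc m) → ℕ) →
  ∑ (kSubsets (suc k) (suc m)) f ≡
  ∑[ s ∈ kSubsets k m ] f (true ∷ s) + ∑[ s ∈ kSubsets (suc k) m ] f (false ∷ s)
∑-kSubsets-suc k m f = trans (∑-filter _ f (allVecs (suc m)))
  (trans (∑-allVecs m _)
  (cong₂ _+_ (sym (∑-filter _ (λ s → f (true ∷ s)) (allVecs m)))
             (sym (∑-filter _ (λ s → f (false ∷ s)) (allVecs m)))))

_⊆ᵇ_ : ∀ {m} → Subset m → Subset m → Bool
[]      ⊆ᵇ []      = true
(x ∷ s) ⊆ᵇ (y ∷ D) = (not x ∨ y) ∧ (s ⊆ᵇ D)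

nC0≡1 : ∀ n → n binom 0 ≡ 1
nC0≡1 zero    = refl
nC0≡1 (suc n) = refl

count-⊆ : ∀ k {m} (D : Subset m) → ∑[ s ∈ kSubsets k m ] ⟦ s ⊆ᵇ D ⟧ ≡ ∣ D ∣ binom k
count-⊆ zero    []      = refl
count-⊆ (suc k) []      = refl
count-⊆ zero {suc m} (y ∷ D) =
  trans (∑-kSubsets-zero m _) (trans (count-⊆ 0 D) (trans (nC0≡1 ∣ D ∣) (sym (nC0≡1 ∣ y ∷ D ∣))))
count-⊆ (suc k) {suc m} (true ∷ D) =
  trans (∑-kSubsets-suc k m _)
  (trans (cong₂ _+_ (count-⊆ k D) (count-⊆ (suc k) D)) (nCk+nC[k+1]≡[n+1]C[k+1] ∣ D ∣ k))
count-⊆ (suc k) {suc m} (false ∷ D) =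
  trans (∑-kSubsets-suc k m _) (cong₂ _+_ (∑-zero (kSubsets k m)) (count-⊆ (suc k) D))

length-kSubsets : ∀ k m → length (kSubsets k m) ≡ m binom k
length-kSubsets k m = trans (length≡∑ (kSubsets k m)) (go k m)
  where
  go : ∀ k m → ∑[ s ∈ kSubsets k m ] 1 ≡ m binom k
  go zero    zero    = refl
  go (suc k) zero    = refl
  go zero    (suc m) = trans (∑-kSubsets-zero m _) (trans (go 0 m) (nC0≡1 m))
  go (suc k) (suc m) = trans (∑-kSubsets-suc k m _)
    (trans (cong₂ _+_ (go k m) (go (suc k) m)) (nCk+nC[k+1]≡[n+1]C[k+1] m k))

-- By induction through Pascal's rule. It yields proportions of k-subsets such as k/m without
-- division.
absorption : ∀ n k → suc k * (suc n binom suc k) ≡ suc n * (n binom k)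
absorption n zero = trans (+-identityʳ _) (trans (sym (nCk+nC[k+1]≡[n+1]C[k+1] n 0)) (trans (cong₂ _+_ (nC0≡1 n) (nC1≡n n)) (sym (trans (cong (suc n *_) (nC0≡1 n)) (*-identityʳ _)))))
absorption zero (suc k) = *-zeroʳ (suc (suc k))
absorption (suc n) (suc k) = begin
  suc (suc k) * (suc (suc n) binom suc (suc k))
    ≡⟨ cong (suc (suc k) *_) (sym (nCk+nC[k+1]≡[n+1]C[k+1] (suc n) (suc k))) ⟩
  suc (suc k) * (x + (suc n binom suc (suc k)))
    ≡⟨ *-distribˡ-+ (suc (suc k)) x _ ⟩
  (x + suc k * x) + suc (suc k) * (suc n binom suc (suc k))
    ≡⟨ cong₂ (λ a b → (x + a) + b) (absorption n k) (absorption n (suc k)) ⟩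
  (x + suc n * (n binom k)) + suc n * (n binom suc k)
    ≡⟨ +-assoc x _ _ ⟩
  x + (suc n * (n binom k) + suc n * (n binom suc k))
    ≡⟨ cong (x +_) (sym (*-distribˡ-+ (suc n) (n binom k) _)) ⟩
  x + suc n * (n binom k + n binom suc k)
    ≡⟨ cong (λ z → x + suc n * z) (nCk+nC[k+1]≡[n+1]C[k+1] n k) ⟩
  suc (suc n) * x ∎
  where
  open ≡-Reasoning
  x = suc n binom suc k

count-∋ : ∀ k {m} (c : Fin (suc m)) → ∑[ s ∈ kSubsets (suc k) (suc m) ] ⟦ lookup s c ⟧ ≡ m binom k
count-∋-zero : ∀ {m} (c : Fin m) → ∑[ s ∈ kSubsets 0 m ] ⟦ lookup s c ⟧ ≡ 0

count-∋-zero {suc m} zero    = trans (∑-kSubsets-zero m _) (∑-zero (kSubsets 0 m))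
count-∋-zero {suc m} (suc c) = trans (∑-kSubsets-zero m _) (count-∋-zero c)

count-∋ k {m} zero = trans (∑-kSubsets-suc k m _)
  (trans (cong₂ _+_ (trans (sym (length≡∑ (kSubsets k m))) (length-kSubsets k m)) (∑-zero (kSubsets (suc k) m)))
         (+-identityʳ _))
count-∋ zero {suc m} (suc c) = trans (∑-kSubsets-suc 0 (suc m) _)
  (cong₂ _+_ (count-∋-zero c) (trans (count-∋ 0 c) (nC0≡1 m)))
count-∋ (suc k) {suc m} (suc c) = trans (∑-kSubsets-suc (suc k) (suc m) _)
  (trans (cong₂ _+_ (count-∋ k c) (count-∋ (suc k) c)) (nCk+nC[k+1]≡[n+1]C[k+1] m k))

_meets_ : ∀ {m} → Subset m → Subset m → Bool
_meets_ {m} s t = any (λ c → lookup s c ∧ lookup t c) (allFin m)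

-- Union bound over the colours of `t`: each of them lies in a proportion k/m of the k-subsets,
-- which `per-colour` reads off from `absorption`.
count-meets : ∀ k {m} (t : Subset m) →
  m * ∑[ s ∈ kSubsets k m ] ⟦ t meets s ⟧ ≤ k * ∣ t ∣ * length (kSubsets k m)
count-meets k {m} t = begin
  m * ∑[ s ∈ K ] ⟦ t meets s ⟧
    ≤⟨ *-monoʳ-≤ m (∑-mono K (λ s → ⟦any⟧≤∑ _ (allFin m))) ⟩
  m * ∑[ s ∈ K ] ∑[ c ∈ allFin m ] ⟦ lookup t c ∧ lookup s c ⟧
    ≡⟨ cong (m *_) (∑-swap _ K (allFin m)) ⟩
  m * ∑[ c ∈ allFin m ] ∑[ s ∈ K ] ⟦ lookup t c ∧ lookup s c ⟧
    ≡⟨ cong (m *_) (∑-cong (λ c → trans (∑-cong (λ s → ⟦∧⟧ (lookup t c) (lookup s c)) K) (∑-*ˡ ⟦ lookup t c ⟧ (λ s → ⟦ lookup s c ⟧) K)) (allFin m)) ⟩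
  m * ∑[ c ∈ allFin m ] (⟦ lookup t c ⟧ * ∑[ s ∈ K ] ⟦ lookup s c ⟧)
    ≡⟨ sym (∑-*ˡ m _ (allFin m)) ⟩
  ∑[ c ∈ allFin m ] (m * (⟦ lookup t c ⟧ * ∑[ s ∈ K ] ⟦ lookup s c ⟧))
    ≡⟨ ∑-cong (λ c → trans (x∙yz≈y∙xz m ⟦ lookup t c ⟧ _) (trans (cong (⟦ lookup t c ⟧ *_) (per-colour k c)) (*-comm ⟦ lookup t c ⟧ _))) (allFin m) ⟩
  ∑[ c ∈ allFin m ] (k * length K * ⟦ lookup t c ⟧)
    ≡⟨ ∑-*ˡ (k * length K) _ (allFin m) ⟩
  k * length K * ∑[ c ∈ allFin m ] ⟦ lookup t c ⟧
    ≡⟨ cong (k * length K *_) (sym (card≡∑ t)) ⟩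
  k * length K * ∣ t ∣
    ≡⟨ trans (*-assoc k _ _) (trans (cong (k *_) (*-comm (length K) _)) (sym (*-assoc k _ _))) ⟩
  k * ∣ t ∣ * length K ∎
  where
  open ≤-Reasoning
  K = kSubsets k m
  per-colour : ∀ k {m} (c : Fin m) →
    m * ∑[ s ∈ kSubsets k m ] ⟦ lookup s c ⟧ ≡ k * length (kSubsets k m)
  per-colour zero    {m} c = trans (cong (m *_) (count-∋-zero c)) (*-zeroʳ m)
  per-colour (suc k) {suc m} c = trans (cong (suc m *_) (count-∋ k c))
    (trans (sym (absorption m k)) (cong (suc k *_) (sym (length-kSubsets (suc k) (suc m)))))

-- The quotient of the two binomials is the product of the ratios (d-i)/(m-i), none of which exceeds
-- d/m. The ratio is generalised to a/b with d/m ≤ a/b ≤ 1 because the induction lowers `d` and `m`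
-- while the ratio must stay fixed.
C-ratio : ∀ k {d m a b} → d ≤ m → a ≤ b → d * b ≤ m * a → (d binom k) * b ^ k ≤ (m binom k) * a ^ k
C-ratio zero {d} {m} _ _ _ = ≤-reflexive (cong (_* 1) (trans (nC0≡1 d) (sym (nC0≡1 m))))
C-ratio (suc k) {zero} _ _ _ = z≤n
C-ratio (suc k) {suc d} {suc m} {a} {b} (s≤s d≤m) a≤b db≤ma = *-cancelˡ-≤ (suc k) (begin
  suc k * ((suc d binom suc k) * (b * b ^ k))
    ≡⟨ sym (*-assoc (suc k) (suc d binom suc k) _) ⟩
  suc k * (suc d binom suc k) * (b * b ^ k)
    ≡⟨ cong (_* (b * b ^ k)) (absorption d k) ⟩
  suc d * (d binom k) * (b * b ^ k)
    ≡⟨ interchange (suc d) (d binom k) b (b ^ k) ⟩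
  suc d * b * ((d binom k) * b ^ k)
    ≤⟨ *-mono-≤ db≤ma (C-ratio k d≤m a≤b db≤ma′) ⟩
  suc m * a * ((m binom k) * a ^ k)
    ≡⟨ interchange (suc m) a (m binom k) (a ^ k) ⟩
  suc m * (m binom k) * (a * a ^ k)
    ≡⟨ cong (_* (a * a ^ k)) (sym (absorption m k)) ⟩
  suc k * (suc m binom suc k) * (a * a ^ k)
    ≡⟨ *-assoc (suc k) (suc m binom suc k) _ ⟩
  suc k * ((suc m binom suc k) * (a * a ^ k)) ∎)
  where
  open ≤-Reasoning
  db≤ma′ : d * b ≤ m * a
  db≤ma′ = +-cancelˡ-≤ b _ _ (≤-trans db≤ma (+-monoˡ-≤ (m * a) a≤b))

count-⊆-≤ : ∀ k {m} (D : Subset m) →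
  m ^ k * ∑[ s ∈ kSubsets k m ] ⟦ s ⊆ᵇ D ⟧ ≤ ∣ D ∣ ^ k * length (kSubsets k m)
count-⊆-≤ k {m} D = begin
  m ^ k * ∑[ s ∈ kSubsets k m ] ⟦ s ⊆ᵇ D ⟧ ≡⟨ cong (m ^ k *_) (count-⊆ k D) ⟩
  m ^ k * (∣ D ∣ binom k)                       ≡⟨ *-comm (m ^ k) _ ⟩
  (∣ D ∣ binom k) * m ^ k                         ≤⟨ C-ratio k (∣p∣≤n D) (∣p∣≤n D) (≤-reflexive (*-comm ∣ D ∣ m)) ⟩
  (m binom k) * ∣ D ∣ ^ k                         ≡⟨ *-comm (m binom k) _ ⟩
  ∣ D ∣ ^ k * (m binom k)                       ≡⟨ cong (∣ D ∣ ^ k *_) (sym (length-kSubsets k m)) ⟩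
  ∣ D ∣ ^ k * length (kSubsets k m)         ∎
  where
  open ≤-Reasoning

-- A set of at most `d` colours is described by `d` choices among the m colours and a blank. The
-- induction splits on the first colour and uses x^d + x^(d+1) ≤ (x+1)^(d+1) for x = m + 1.
count-small : ∀ m d → ∑[ D ∈ allVecs m ] ⟦ ∣ D ∣ ≤ᵇ d ⟧ ≤ suc m ^ d
count-small zero    d       = ≤-reflexive (sym (^-zeroˡ d))
count-small (suc m) zero    = begin
  ∑[ D ∈ allVecs (suc m) ] ⟦ ∣ D ∣ ≤ᵇ 0 ⟧ ≡⟨ ∑-allVecs m _ ⟩
  ∑[ D ∈ allVecs m ] 0 + ∑[ D ∈ allVecs m ] ⟦ ∣ D ∣ ≤ᵇ 0 ⟧ ≡⟨ cong (_+ ∑[ D ∈ allVecs m ] ⟦ ∣ D ∣ ≤ᵇ 0 ⟧) (∑-zero (allVecs m)) ⟩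
  ∑[ D ∈ allVecs m ] ⟦ ∣ D ∣ ≤ᵇ 0 ⟧ ≤⟨ count-small m 0 ⟩
  1 ∎
  where open ≤-Reasoning
count-small (suc m) (suc d) = begin
  ∑[ D ∈ allVecs (suc m) ] ⟦ ∣ D ∣ ≤ᵇ suc d ⟧
    ≡⟨ ∑-allVecs m _ ⟩
  ∑[ D ∈ allVecs m ] ⟦ ∣ D ∣ <ᵇ suc d ⟧ + ∑[ D ∈ allVecs m ] ⟦ ∣ D ∣ ≤ᵇ suc d ⟧
    ≤⟨ +-mono-≤ (≤-trans (≤-reflexive (∑-cong (λ D → cong ⟦_⟧ (<ᵇ-suc ∣ D ∣ d)) (allVecs m))) (count-small m d)) (count-small m (suc d)) ⟩
  suc m ^ d + suc m ^ suc d
    ≤⟨ *-monoʳ-≤ (suc (suc m)) (^-monoˡ-≤ d (n≤1+n (suc m))) ⟩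
  suc (suc m) ^ suc d ∎
  where
  open ≤-Reasoning
  <ᵇ-suc : ∀ a d → (a <ᵇ suc d) ≡ (a ≤ᵇ d)
  <ᵇ-suc zero    d = refl
  <ᵇ-suc (suc a) d = refl

-- Random list assignments

module Assignments (k m : ℕ) where

  K : List (Subset m)
  K = kSubsets k m

  assignments : ∀ n → List (Vec (Subset m) n)
  assignments n = allAssignments k n m

  count : (Vec (Subset m) n → Bool) → ℕ
  count P = ∑[ L ∈ assignments _ ] ⟦ P L ⟧

  ∑-assignments : (F : Vec (Subset m) (suc n) → ℕ) →
    ∑ (assignments (suc n)) F ≡ ∑[ s ∈ K ] ∑[ L ∈ assignments n ] F (s ∷ L)
  ∑-assignments {n} F = trans (∑-concatMap F _ K) (∑-cong (λ s → ∑-map F (s ∷_) (assignments n)) K)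

  ∈-assignments⇒card : ∀ {L : Vec (Subset m) n} → L ∈ assignments n → ∀ v → ∣ lookup L v ∣ ≡ k
  ∈-assignments⇒card {suc n} L∈ v with find (∈-concatMap⁻ (λ s → map (s ∷_) (assignments n)) {xs = K} L∈)
  ... | s , s∈K , L∈map with ∈-map⁻ (s ∷_) L∈map
  ∈-assignments⇒card {suc n} L∈ zero    | s , s∈K , _ | L′ , _ , refl =
    proj₂ (∈-filter⁻ (λ s → ∣ s ∣ ≟ k) {xs = allVecs m} s∈K)
  ∈-assignments⇒card {suc n} L∈ (suc v) | s , s∈K , _ | L′ , L′∈ , refl = ∈-assignments⇒card L′∈ v

  -- Redrawing the list at `w` in a uniform assignment gives a uniform assignment again: each one
  -- arises from exactly |K| pairs. All independence of lists used later comes from here.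
  resample : (w : Fin n) (F : Vec (Subset m) n → ℕ) →
    ∑[ L ∈ assignments n ] ∑[ s ∈ K ] F (L [ w ]≔ s) ≡ length K * ∑ (assignments n) F
  resample {suc n} zero F = begin
    ∑[ L ∈ assignments (suc n) ] ∑[ s ∈ K ] F (L [ zero ]≔ s)
      ≡⟨ ∑-assignments {n} _ ⟩
    ∑[ t ∈ K ] ∑[ L ∈ assignments n ] ∑[ s ∈ K ] F (s ∷ L)
      ≡⟨ ∑-const _ K ⟩
    length K * ∑[ L ∈ assignments n ] ∑[ s ∈ K ] F (s ∷ L)
      ≡⟨ cong (length K *_) (∑-swap _ (assignments n) K) ⟩
    length K * ∑[ s ∈ K ] ∑[ L ∈ assignments n ] F (s ∷ L)
      ≡⟨ cong (length K *_) (sym (∑-assignments F)) ⟩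
    length K * ∑ (assignments (suc n)) F ∎
    where open ≡-Reasoning
  resample {suc n} (suc w) F = begin
    ∑[ L ∈ assignments (suc n) ] ∑[ s ∈ K ] F (L [ suc w ]≔ s)
      ≡⟨ ∑-assignments {n} _ ⟩
    ∑[ t ∈ K ] ∑[ L ∈ assignments n ] ∑[ s ∈ K ] F (t ∷ L [ w ]≔ s)
      ≡⟨ ∑-cong (λ t → resample w (λ L → F (t ∷ L))) K ⟩
    ∑[ t ∈ K ] (length K * ∑[ L ∈ assignments n ] F (t ∷ L))
      ≡⟨ ∑-*ˡ (length K) _ K ⟩
    length K * ∑[ t ∈ K ] ∑[ L ∈ assignments n ] F (t ∷ L)
      ≡⟨ cong (length K *_) (sym (∑-assignments F)) ⟩
    length K * ∑ (assignments (suc n)) F ∎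
    where open ≡-Reasoning

  ∑-assignments-empty : length K ≡ 0 → Fin n → (F : Vec (Subset m) n → ℕ) → ∑ (assignments n) F ≡ 0
  ∑-assignments-empty {suc n} K≡0 _ F = trans (∑-assignments F) (empty K K≡0)
    where
    empty : ∀ {f : Subset m → ℕ} xs → length xs ≡ 0 → ∑ xs f ≡ 0
    empty [] _ = refl

  -- A conditional probability bound: if, for every choice of the other lists, a fresh list at `w`
  -- satisfies `Q` with probability at most β/α, then the same bound holds conditionally on an event
  -- `P` that does not see the list at `w`.
  decouple : ∀ (w : Fin n) (P : Vec (Subset m) n → Bool) (Q : Vec (Subset m) n → Subset m → Bool) α β →
    (∀ L s → P (L [ w ]≔ s) ≡ P L) →
    (∀ L s t → Q (L [ w ]≔ s) t ≡ Q L t) →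
    (∀ {L} → L ∈ assignments n → α * ∑[ s ∈ K ] ⟦ Q L s ⟧ ≤ β * length K) →
    α * count (λ L → P L ∧ Q L (lookup L w)) ≤ β * count P
  decouple {n} w P Q α β P-indep Q-indep Q≤ = cancel (length K) refl
    where
    PQ : Vec (Subset m) n → ℕ
    PQ L = ⟦ P L ∧ Q L (lookup L w) ⟧

    resampled : ∀ L s → PQ (L [ w ]≔ s) ≡ ⟦ P L ⟧ * ⟦ Q L s ⟧
    resampled L s rewrite lookup∘update w L s | P-indep L s | Q-indep L s s = ⟦∧⟧ (P L) (Q L s)

    open ≤-Reasoning
    scaled : length K * (α * ∑ (assignments n) PQ) ≤ length K * (β * count P)
    scaled = begin
      length K * (α * ∑ (assignments n) PQ)
        ≡⟨ x∙yz≈y∙xz (length K) α _ ⟩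
      α * (length K * ∑ (assignments n) PQ)
        ≡⟨ cong (α *_) (sym (resample w PQ)) ⟩
      α * ∑[ L ∈ assignments n ] ∑[ s ∈ K ] PQ (L [ w ]≔ s)
        ≡⟨ cong (α *_) (∑-cong (λ L → trans (∑-cong (resampled L) K) (∑-*ˡ ⟦ P L ⟧ _ K)) (assignments n)) ⟩
      α * ∑[ L ∈ assignments n ] (⟦ P L ⟧ * ∑[ s ∈ K ] ⟦ Q L s ⟧)
        ≡⟨ sym (∑-*ˡ α _ (assignments n)) ⟩
      ∑[ L ∈ assignments n ] (α * (⟦ P L ⟧ * ∑[ s ∈ K ] ⟦ Q L s ⟧))
        ≤⟨ ∑-mono-∈ (assignments n) (λ {L} L∈ → begin
             α * (⟦ P L ⟧ * ∑[ s ∈ K ] ⟦ Q L s ⟧) ≡⟨ x∙yz≈y∙xz α ⟦ P L ⟧ _ ⟩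
             ⟦ P L ⟧ * (α * ∑[ s ∈ K ] ⟦ Q L s ⟧) ≤⟨ *-monoʳ-≤ ⟦ P L ⟧ (Q≤ L∈) ⟩
             ⟦ P L ⟧ * (β * length K)             ≡⟨ *-comm ⟦ P L ⟧ _ ⟩
             β * length K * ⟦ P L ⟧               ∎) ⟩
      ∑[ L ∈ assignments n ] (β * length K * ⟦ P L ⟧)
        ≡⟨ ∑-*ˡ (β * length K) _ (assignments n) ⟩
      β * length K * count P
        ≡⟨ trans (cong (_* count P) (*-comm β _)) (*-assoc (length K) β _) ⟩
      length K * (β * count P) ∎

    -- Dividing by |K| fails if there are no k-subsets; then there are no assignments either,
    -- because `w` is a vertex needing a list.
    cancel : ∀ l → length K ≡ l → α * ∑ (assignments n) PQ ≤ β * count P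
    cancel zero    K≡0 = ≤-trans (≤-reflexive (trans (cong (α *_) (∑-assignments-empty K≡0 w PQ)) (*-zeroʳ α))) z≤n
    cancel (suc l) K≡l = *-cancelˡ-≤ (suc l) (subst (λ x → x * (α * ∑ (assignments n) PQ) ≤ x * (β * count P)) K≡l scaled)

-- Exploring a graph

module Exploration {n : ℕ} (G : Graph n) where

  open import Data.List.Membership.DecPropositional (Fin._≟_ {n}) public using (_∈?_)

  neighbours : Fin n → List (Fin n)
  neighbours v = filter (λ u → adj G v u Bool.≟ true) (allFin n)

  ∈-neighbours : ∀ {u v} → adj G u v ≡ true → v ∈ neighbours u
  ∈-neighbours {u} {v} uv = ∈-filter⁺ (λ w → adj G u w Bool.≟ true) (∈-allFin v) uv

  edges : Fin n → List (Fin n × Fin n)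
  edges v = map (v ,_) (neighbours v)

  -- X is the set of vertices found, Q the queue of edges still to be tested; the search accepts
  -- once r further vertices have been found along edges satisfying R.
  explore : (Fin n → Fin n → Bool) → ℕ → List (Fin n) → List (Fin n × Fin n) → Bool
  explore R zero    X Q             = true
  explore R (suc r) X []            = false
  explore R (suc r) X ((u , w) ∷ Q) =
    if not (does (w ∈? X)) ∧ R u w
    then explore R r (w ∷ X) (Q ++ edges w)
    else explore R (suc r) X Q

  -- All sequences of i + 1 distinct vertices, newest first, each adjacent to an earlier one.
  sequences : ℕ → List (List (Fin n))
  sequences zero    = map [_] (allFin n)
  sequences (suc i) = concatMap (λ X → concatMap (λ u →
    map (_∷ X) (filter (λ w → ¬? (w ∈? X)) (neighbours u))) X) (sequences i)

  ∈-sequences-suc : ∀ i {Y} → Y ∈ sequences (suc i) →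
    ∃[ X ] ∃[ w ] (X ∈ sequences i × w ∉ X × Y ≡ w ∷ X)
  ∈-sequences-suc i Y∈ with find (∈-concatMap⁻ _ {xs = sequences i} Y∈)
  ... | X , X∈ , Y∈X with find (∈-concatMap⁻ _ {xs = X} Y∈X)
  ... | u , _ , Y∈u with ∈-map⁻ (_∷ X) Y∈u
  ... | w , w∈ , Y≡ = X , w , X∈ , proj₂ (∈-filter⁻ (λ w → ¬? (w ∈? X)) {xs = neighbours u} w∈) , Y≡

  sequences-length : ∀ i {X} → X ∈ sequences i → length X ≡ suc i
  sequences-length zero X∈ with ∈-map⁻ [_] X∈
  ... | _ , _ , refl = refl
  sequences-length (suc i) Y∈ with ∈-sequences-suc i Y∈
  ... | X , w , X∈ , _ , refl = cong suc (sequences-length i X∈)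

  sequences-unique : ∀ i {X} → X ∈ sequences i → Unique X
  sequences-unique zero X∈ with ∈-map⁻ [_] X∈
  ... | _ , _ , refl = [] ∷ []
  sequences-unique (suc i) Y∈ with ∈-sequences-suc i Y∈
  ... | X , w , X∈ , w∉X , refl = ¬Any⇒All¬ X w∉X ∷ sequences-unique i X∈

  -- Each extension chooses an earlier vertex and one of its at most `Δ` neighbours; all these
  -- factors are rounded up to the last one. A sequence reached through several earlier vertices is
  -- listed repeatedly, which is harmless for an upper bound.
  length-sequences : ∀ {Δ} → (∀ v → degree G v ≤ Δ) → ∀ i → length (sequences i) ≤ n * (i * Δ) ^ i
  length-sequences deg zero = ≤-reflexive (trans (trans (length-map [_] (allFin n)) (length-tabulate {n = n} id)) (sym (*-identityʳ n)))
  length-sequences {Δ} deg (suc i) = begin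
    length (sequences (suc i))
      ≤⟨ length-concatMap _ (sequences i) (λ {X} X∈ →
           ≤-trans (length-concatMap _ X (λ {u} _ → new-neighbours X u))
                   (≤-reflexive (cong (_* Δ) (sequences-length i X∈)))) ⟩
    length (sequences i) * (suc i * Δ)
      ≤⟨ *-monoˡ-≤ (suc i * Δ) (length-sequences deg i) ⟩
    n * (i * Δ) ^ i * (suc i * Δ)
      ≤⟨ *-monoˡ-≤ (suc i * Δ) (*-monoʳ-≤ n (^-monoˡ-≤ i (*-monoˡ-≤ Δ (n≤1+n i)))) ⟩
    n * (suc i * Δ) ^ i * (suc i * Δ)
      ≡⟨ trans (*-assoc n _ _) (cong (n *_) (*-comm ((suc i * Δ) ^ i) _)) ⟩
    n * (suc i * Δ) ^ suc i ∎
    where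
    open ≤-Reasoning
    new-neighbours : ∀ X u → length (map (_∷ X) (filter (λ w → ¬? (w ∈? X)) (neighbours u))) ≤ Δ
    new-neighbours X u = begin
      length (map (_∷ X) (filter (λ w → ¬? (w ∈? X)) (neighbours u))) ≡⟨ length-map (_∷ X) (filter (λ w → ¬? (w ∈? X)) (neighbours u)) ⟩
      length (filter (λ w → ¬? (w ∈? X)) (neighbours u))              ≤⟨ length-filter (λ w → ¬? (w ∈? X)) (neighbours u) ⟩
      degree G u                                                      ≤⟨ deg u ⟩
      Δ ∎

-- Probability estimates for large components and small palettes

IndepOutside : ∀ {n m} → List (Fin n) → (Vec (Subset m) n → Bool) → Set
IndepOutside X P = ∀ w → w ∉ X → ∀ L s → P (L [ w ]≔ s) ≡ P L

conflict : ∀ {n m} → Vec (Subset m) n → Fin n → Fin n → Bool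
conflict L u w = lookup L u meets lookup L w

module Counting (k m : ℕ) {n : ℕ} (G : Graph n) where

  open Assignments k m
  open Exploration G

  module _ {Δ : ℕ} (deg : ∀ v → degree G v ≤ Δ) .{{_ : NonZero k}} (3k²Δ≤m : 3 * k ^ 2 * Δ ≤ m) where

    -- The list of `w` is still fresh under `P`, and `u ≢ w` keeps the list of `u` fixed while it is
    -- redrawn. So the conflict has conditional probability at most k²/m, which is at most 1/(3Δ).
    conflict-count : ∀ P {X} {u w : Fin n} → IndepOutside X P → w ∉ X → u ≢ w →
      3 * Δ * count (λ L → P L ∧ conflict L u w) ≤ count P
    conflict-count P {u = u} {w} P-indep w∉X u≢w =
      ≤-trans (decouple w P (λ L s → lookup L u meets s) (3 * Δ) 1 (P-indep w w∉X)
        (λ L s t → cong (_meets t) (lookup∘update′ u≢w L s)) bound)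
      (≤-reflexive (*-identityˡ _))
      where
      open ≤-Reasoning
      regroup : ∀ k Δ x → k * k * (3 * Δ * x) ≡ 3 * (k * (k * 1)) * Δ * x
      regroup = solve-∀
      bound : ∀ {L} → L ∈ assignments n → 3 * Δ * ∑[ s ∈ K ] ⟦ lookup L u meets s ⟧ ≤ 1 * length K
      bound {L} L∈ = *-cancelˡ-≤ (k * k) {{m*n≢0 k k}} (begin
        k * k * (3 * Δ * x)        ≡⟨ regroup k Δ x ⟩
        3 * k ^ 2 * Δ * x          ≤⟨ *-monoˡ-≤ x 3k²Δ≤m ⟩
        m * x                      ≤⟨ count-meets k (lookup L u) ⟩
        k * ∣ lookup L u ∣ * length K ≡⟨ cong (λ c → k * c * length K) (∈-assignments⇒card L∈ u) ⟩
        k * k * length K           ≡⟨ cong (k * k *_) (sym (*-identityˡ (length K))) ⟩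
        k * k * (1 * length K)     ∎)
        where x = ∑[ s ∈ K ] ⟦ lookup L u meets s ⟧

    -- The factor per found vertex is (1 + 1/Δ)^Δ / 3 < 1: this is where the constant 3 is needed.
    explore-count : ∀ r X Q q P → length Q ≤ q → All (λ e → proj₁ e ∈ X) Q → IndepOutside X P →
      count (λ L → P L ∧ explore (conflict L) r X Q) * (3 ^ r * Δ ^ (q + r * Δ))
      ≤ suc Δ ^ (q + r * Δ) * count P
    explore-count zero X Q q P _ _ _ = begin
      count (λ L → P L ∧ true) * (1 * Δ ^ (q + 0))
        ≡⟨ cong₂ _*_ (∑-cong (λ L → cong ⟦_⟧ (∧-identityʳ (P L))) (assignments n)) (*-identityˡ _) ⟩
      count P * Δ ^ (q + 0)        ≤⟨ *-monoʳ-≤ (count P) (^-monoˡ-≤ (q + 0) (n≤1+n Δ)) ⟩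
      count P * suc Δ ^ (q + 0)    ≡⟨ *-comm (count P) _ ⟩
      suc Δ ^ (q + 0) * count P    ∎
      where open ≤-Reasoning
    explore-count (suc r) X [] q P _ _ _ = begin
      count (λ L → P L ∧ false) * (3 ^ suc r * Δ ^ (q + suc r * Δ))
        ≡⟨ cong (_* _) (trans (∑-cong (λ L → cong ⟦_⟧ (∧-zeroʳ (P L))) (assignments n)) (∑-zero (assignments n))) ⟩
      0 ≤⟨ z≤n ⟩
      suc Δ ^ (q + suc r * Δ) * count P ∎
      where open ≤-Reasoning
    explore-count (suc r) X ((u , w) ∷ Q) (suc q) P (s≤s Q≤q) (u∈X ∷ Q⊆X) P-indep
      with w ∈? X | explore-count (suc r) X Q q P Q≤q Q⊆X P-indep
    ... | yes _ | ih = begin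
      c * (3 ^ suc r * (Δ * Δ ^ e))   ≡⟨ cong (c *_) (x∙yz≈y∙xz (3 ^ suc r) Δ _) ⟩
      c * (Δ * (3 ^ suc r * Δ ^ e))   ≡⟨ x∙yz≈y∙xz c Δ _ ⟩
      Δ * (c * (3 ^ suc r * Δ ^ e))   ≤⟨ *-mono-≤ (n≤1+n Δ) ih ⟩
      suc Δ * (suc Δ ^ e * count P)   ≡⟨ sym (*-assoc (suc Δ) (suc Δ ^ e) _) ⟩
      suc Δ ^ suc e * count P         ∎
      where
      open ≤-Reasoning
      e = q + suc r * Δ
      c = count (λ L → P L ∧ explore (conflict L) (suc r) X Q)
    ... | no w∉X | ih = begin
      c * (3 * 3 ^ r * (Δ * Δ ^ e))
        ≤⟨ *-monoˡ-≤ (3 * 3 ^ r * (Δ * Δ ^ e)) c≤c₁+c₂ ⟩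
      (c₁ + c₂) * (3 * 3 ^ r * (Δ * Δ ^ e))
        ≡⟨ expand c₁ c₂ (3 ^ r) Δ (Δ ^ e) ⟩
      Δ * (c₁ * (3 * 3 ^ r * Δ ^ e)) + 3 * Δ * (c₂ * (3 ^ r * Δ ^ e))
        ≤⟨ +-mono-≤ (*-monoʳ-≤ Δ ih) (*-monoʳ-≤ (3 * Δ) ih′) ⟩
      Δ * (suc Δ ^ e * count P) + 3 * Δ * (suc Δ ^ e * count P′)
        ≡⟨ cong (Δ * (suc Δ ^ e * count P) +_) (x∙yz≈y∙xz (3 * Δ) (suc Δ ^ e) _) ⟩
      Δ * (suc Δ ^ e * count P) + suc Δ ^ e * (3 * Δ * count P′)
        ≤⟨ +-monoʳ-≤ (Δ * (suc Δ ^ e * count P)) (*-monoʳ-≤ (suc Δ ^ e) (conflict-count P P-indep w∉X u≢w)) ⟩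
      Δ * (suc Δ ^ e * count P) + suc Δ ^ e * count P
        ≡⟨ trans (+-comm _ (suc Δ ^ e * count P)) (sym (*-assoc (suc Δ) (suc Δ ^ e) _)) ⟩
      suc Δ ^ suc e * count P ∎
      where
      open ≤-Reasoning
      e = q + suc r * Δ
      c = count (λ L → P L ∧ (if conflict L u w then explore (conflict L) r (w ∷ X) (Q ++ edges w)
                              else explore (conflict L) (suc r) X Q))
      c₁ = count (λ L → P L ∧ explore (conflict L) (suc r) X Q)
      P′ : Vec (Subset m) n → Bool
      P′ L = P L ∧ conflict L u w
      c₂ = count (λ L → P′ L ∧ explore (conflict L) r (w ∷ X) (Q ++ edges w))

      u≢w : u ≢ w
      u≢w refl = w∉X u∈X

      -- The failing branch forgets that the test failed. Remembering it would tie `P` to the list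
      -- of `w`, which lies outside `X`, and destroy `IndepOutside X P`.
      either : ∀ p b x y → ⟦ p ∧ (if b then x else y) ⟧ ≤ ⟦ p ∧ y ⟧ + ⟦ (p ∧ b) ∧ x ⟧
      either false b     x y = z≤n
      either true  true  x y = m≤n+m ⟦ x ⟧ ⟦ y ⟧
      either true  false x y = m≤m+n ⟦ y ⟧ 0

      c≤c₁+c₂ : c ≤ c₁ + c₂
      c≤c₁+c₂ = ≤-trans (∑-mono (assignments n) (λ L → either (P L) (conflict L u w) _ _))
        (≤-reflexive (∑-+ _ _ (assignments n)))

      P′-indep : IndepOutside (w ∷ X) P′
      P′-indep x x∉ L s = cong₂ _∧_ (P-indep x (x∉ ∘ there) L s)
        (cong₂ _meets_ (lookup∘update′ (λ { refl → x∉ (there u∈X) }) L s)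
                       (lookup∘update′ (λ { refl → x∉ (here refl) }) L s))

      Q++≤ : length (Q ++ edges w) ≤ q + Δ
      Q++≤ = ≤-trans (≤-reflexive (trans (length-++ Q) (cong (length Q +_) (length-map (w ,_) (neighbours w)))))
        (+-mono-≤ Q≤q (deg w))

      -- A success exchanges the Δ tests reserved for one missing vertex for the at most Δ edges
      -- queued at `w`, so both branches have the same exponent `e`.
      ih′ : c₂ * (3 ^ r * Δ ^ e) ≤ suc Δ ^ e * count P′
      ih′ = subst (λ e → c₂ * (3 ^ r * Δ ^ e) ≤ suc Δ ^ e * count P′) (+-assoc q Δ (r * Δ))
        (explore-count r (w ∷ X) (Q ++ edges w) (q + Δ) P′ Q++≤
          (++⁺ (All.map there Q⊆X) (map⁺ (All.universal (λ _ → here refl) (neighbours w)))) P′-indep)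

      expand : ∀ a b t d x → (a + b) * (3 * t * (d * x)) ≡ d * (a * (3 * t * x)) + 3 * d * (b * (t * x))
      expand = solve-∀

    explore-count-from : ∀ r v →
      count (λ L → explore (conflict L) r [ v ] (edges v)) * (3 ^ r * Δ ^ (suc r * Δ))
      ≤ suc Δ ^ (suc r * Δ) * totalCount k n m
    explore-count-from r v = ≤-trans
      (explore-count r [ v ] (edges v) Δ (λ _ → true)
        (≤-trans (≤-reflexive (length-map (v ,_) (neighbours v))) (deg v))
        (map⁺ (All.universal (λ _ → here refl) (neighbours v))) (λ _ _ _ _ → refl))
      (≤-reflexive (cong (suc Δ ^ (suc r * Δ) *_) (sym (length≡∑ (assignments n)))))

  contained : Subset m → List (Fin n) → Vec (Subset m) n → Bool
  contained D X L = all (λ u → lookup L u ⊆ᵇ D) X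

  contained-indep : ∀ D X → IndepOutside X (contained D X)
  contained-indep D []      w w∉ L s = refl
  contained-indep D (x ∷ X) w w∉ L s = cong₂ _∧_
    (cong (_⊆ᵇ D) (lookup∘update′ (λ { refl → w∉ (here refl) }) L s))
    (contained-indep D X w (w∉ ∘ there) L s)

  -- One use of `decouple` per vertex: distinctness keeps the list of the head fresh, and
  -- `count-⊆-≤` supplies the factor (|D|/m)^k.
  contained-count : ∀ D {X} → Unique X →
    (m ^ k) ^ length X * count (contained D X) ≤ (∣ D ∣ ^ k) ^ length X * totalCount k n m
  contained-count D [] = ≤-reflexive (cong (1 *_) (sym (length≡∑ (assignments n))))
  contained-count D {x ∷ X} (x∉X ∷ uX) = begin
    m ^ k * (m ^ k) ^ length X * count (contained D (x ∷ X))
      ≡⟨ cong (m ^ k * (m ^ k) ^ length X *_)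
              (∑-cong (λ L → cong ⟦_⟧ (∧-comm (lookup L x ⊆ᵇ D) (contained D X L))) (assignments n)) ⟩
    m ^ k * (m ^ k) ^ length X * c
      ≡⟨ trans (cong (_* c) (*-comm (m ^ k) _)) (*-assoc ((m ^ k) ^ length X) (m ^ k) _) ⟩
    (m ^ k) ^ length X * (m ^ k * c)
      ≤⟨ *-monoʳ-≤ ((m ^ k) ^ length X) (decouple x (contained D X) (λ _ s → s ⊆ᵇ D) (m ^ k) (∣ D ∣ ^ k)
           (contained-indep D X x (All¬⇒¬Any x∉X)) (λ _ _ _ → refl) (λ _ → count-⊆-≤ k D)) ⟩
    (m ^ k) ^ length X * (∣ D ∣ ^ k * count (contained D X))
      ≡⟨ x∙yz≈y∙xz ((m ^ k) ^ length X) (∣ D ∣ ^ k) _ ⟩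
    ∣ D ∣ ^ k * ((m ^ k) ^ length X * count (contained D X))
      ≤⟨ *-monoʳ-≤ (∣ D ∣ ^ k) (contained-count D uX) ⟩
    ∣ D ∣ ^ k * ((∣ D ∣ ^ k) ^ length X * totalCount k n m)
      ≡⟨ sym (*-assoc (∣ D ∣ ^ k) _ _) ⟩
    ∣ D ∣ ^ k * (∣ D ∣ ^ k) ^ length X * totalCount k n m ∎
    where
    open ≤-Reasoning
    c = count (λ L → contained D X L ∧ (lookup L x ⊆ᵇ D))

  -- A number of pairs rather than a Boolean, so that summing it over all assignments is already the
  -- union bound.
  confined : ℕ → ℕ → Vec (Subset m) n → ℕ
  confined d i L = ∑[ X ∈ sequences i ] ∑[ D ∈ allVecs m ] (⟦ ∣ D ∣ ≤ᵇ d ⟧ * ⟦ contained D X L ⟧)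

  confined-count : ∀ d i →
    (m ^ k) ^ suc i * ∑[ L ∈ assignments n ] confined d i L
    ≤ length (sequences i) * (suc m ^ d * ((d ^ k) ^ suc i * totalCount k n m))
  confined-count d i = begin
    M * ∑[ L ∈ assignments n ] confined d i L
      ≡⟨ cong (M *_) (∑-swap _ (assignments n) (sequences i)) ⟩
    M * ∑[ X ∈ sequences i ] ∑[ L ∈ assignments n ] ∑[ D ∈ allVecs m ] term D X L
      ≡⟨ sym (∑-*ˡ M _ (sequences i)) ⟩
    ∑[ X ∈ sequences i ] (M * ∑[ L ∈ assignments n ] ∑[ D ∈ allVecs m ] term D X L)
      ≤⟨ ∑-≤length (sequences i) per-sequence ⟩
    length (sequences i) * (suc m ^ d * T) ∎
    where
    open ≤-Reasoning
    M = (m ^ k) ^ suc i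
    T = (d ^ k) ^ suc i * totalCount k n m
    term : Subset m → List (Fin n) → Vec (Subset m) n → ℕ
    term D X L = ⟦ ∣ D ∣ ≤ᵇ d ⟧ * ⟦ contained D X L ⟧

    per-set : ∀ D {X} → X ∈ sequences i → ⟦ ∣ D ∣ ≤ᵇ d ⟧ * (M * count (contained D X)) ≤ T * ⟦ ∣ D ∣ ≤ᵇ d ⟧
    per-set D {X} X∈ with ∣ D ∣ ≤ᵇ d in eq
    ... | false = z≤n
    ... | true  = begin
      1 * (M * count (contained D X))            ≡⟨ *-identityˡ _ ⟩
      M * count (contained D X)                  ≡⟨ cong (λ l → (m ^ k) ^ l * count (contained D X)) (sym (sequences-length i X∈)) ⟩
      (m ^ k) ^ length X * count (contained D X) ≤⟨ contained-count D (sequences-unique i X∈) ⟩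
      (∣ D ∣ ^ k) ^ length X * totalCount k n m  ≡⟨ cong (λ l → (∣ D ∣ ^ k) ^ l * totalCount k n m) (sequences-length i X∈) ⟩
      (∣ D ∣ ^ k) ^ suc i * totalCount k n m     ≤⟨ *-monoˡ-≤ (totalCount k n m) (^-monoˡ-≤ (suc i) (^-monoˡ-≤ k (≤ᵇ⇒≤ ∣ D ∣ d (subst Bool.T (sym eq) _)))) ⟩
      T                                          ≡⟨ sym (*-identityʳ T) ⟩
      T * 1                                      ∎

    per-sequence : ∀ {X} → X ∈ sequences i → M * ∑[ L ∈ assignments n ] ∑[ D ∈ allVecs m ] term D X L ≤ suc m ^ d * T
    per-sequence {X} X∈ = begin
      M * ∑[ L ∈ assignments n ] ∑[ D ∈ allVecs m ] term D X L
        ≡⟨ cong (M *_) (∑-swap _ (assignments n) (allVecs m)) ⟩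
      M * ∑[ D ∈ allVecs m ] ∑[ L ∈ assignments n ] term D X L
        ≡⟨ cong (M *_) (∑-cong (λ D → ∑-*ˡ ⟦ ∣ D ∣ ≤ᵇ d ⟧ _ (assignments n)) (allVecs m)) ⟩
      M * ∑[ D ∈ allVecs m ] (⟦ ∣ D ∣ ≤ᵇ d ⟧ * count (contained D X))
        ≡⟨ sym (∑-*ˡ M _ (allVecs m)) ⟩
      ∑[ D ∈ allVecs m ] (M * (⟦ ∣ D ∣ ≤ᵇ d ⟧ * count (contained D X)))
        ≤⟨ ∑-mono (allVecs m) (λ D → ≤-trans (≤-reflexive (x∙yz≈y∙xz M ⟦ ∣ D ∣ ≤ᵇ d ⟧ _)) (per-set D X∈)) ⟩
      ∑[ D ∈ allVecs m ] (T * ⟦ ∣ D ∣ ≤ᵇ d ⟧)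
        ≡⟨ ∑-*ˡ T _ (allVecs m) ⟩
      T * ∑[ D ∈ allVecs m ] ⟦ ∣ D ∣ ≤ᵇ d ⟧
        ≤⟨ *-monoʳ-≤ T (count-small m d) ⟩
      T * suc m ^ d
        ≡⟨ *-comm T _ ⟩
      suc m ^ d * T ∎

-- Boolean tests, duplicate-free lists and membership of colours

any-true⁻ : (p : A → Bool) (xs : List A) → any p xs ≡ true → ∃[ x ] (x ∈ xs × p x ≡ true)
any-true⁻ p (x ∷ xs) eq with p x in px
... | true  = x , here refl , px
... | false with any-true⁻ p xs eq
...   | y , y∈xs , py = y , there y∈xs , py

all-true : (p : A → Bool) (xs : List A) → (∀ {x} → x ∈ xs → p x ≡ true) → all p xs ≡ true
all-true p []       _  = refl
all-true p (x ∷ xs) ps rewrite ps (here refl) = all-true p xs (ps ∘ there)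

∧-true : ∀ {a b} → a ∧ b ≡ true → a ≡ true × b ≡ true
∧-true {true} {true} refl = refl , refl

lookup-injective : {xs : List A} → Unique xs → ∀ {i j} → List.lookup xs i ≡ List.lookup xs j → i ≡ j
lookup-injective (_    ∷ _)  {zero}  {zero}  _  = refl
lookup-injective (x∉xs ∷ _)  {zero}  {suc j} eq = contradiction eq (All.lookup x∉xs (∈-lookup j))
lookup-injective (x∉xs ∷ _)  {suc i} {zero}  eq = contradiction (sym eq) (All.lookup x∉xs (∈-lookup i))
lookup-injective (_    ∷ u)  {suc i} {suc j} eq = cong suc (lookup-injective u eq)

unique-⊆⇒length-≤ : {xs ys : List A} → Unique xs → (∀ {x} → x ∈ xs → x ∈ ys) → length xs ≤ length ys
unique-⊆⇒length-≤ {xs = xs} {ys} u sub = Fin.injective⇒≤ {f = λ i → index (sub (∈-lookup i))}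
  (λ {i} {j} eq → lookup-injective u
    (trans (lookup-index (sub (∈-lookup i))) (trans (cong (List.lookup ys) eq) (sym (lookup-index (sub (∈-lookup j)))))))

nonempty : ∀ {m} (s : Subset m) → ∣ s ∣ ≢ 0 → ∃[ c ] lookup s c ≡ true
nonempty []          s≢0 = contradiction refl s≢0
nonempty (true ∷ s)  s≢0 = zero , refl
nonempty (false ∷ s) s≢0 with nonempty s s≢0
... | c , c∈s = suc c , c∈s

⊆ᵇ-true : ∀ {m} (s D : Subset m) → (∀ c → lookup s c ≡ true → lookup D c ≡ true) → (s ⊆ᵇ D) ≡ true
⊆ᵇ-true []          []      _   = refl
⊆ᵇ-true (false ∷ s) (y ∷ D) sub = ⊆ᵇ-true s D (sub ∘ suc)
⊆ᵇ-true (true ∷ s)  (y ∷ D) sub rewrite sub zero refl = ⊆ᵇ-true s D (sub ∘ suc)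

-- Colouring in the absence of obstructions

module Colouring {n : ℕ} (G : Graph n) where

  open Exploration G

  Relation : Set
  Relation = Fin n → Fin n → Bool

  -- The order of discovery is kept, newest first, so that a grown set is literally a member of the
  -- counted lists `sequences`.
  data Grown (R : Relation) (v : Fin n) : List (Fin n) → Set where
    root : Grown R v [ v ]
    grow : ∀ {X u w} → Grown R v X → u ∈ X → adj G u w ≡ true → R u w ≡ true → w ∉ X → Grown R v (w ∷ X)

  Closed : Relation → List (Fin n) → Set
  Closed R T = ∀ {u w} → u ∈ T → adj G u w ≡ true → R u w ≡ true → w ∈ T

  root∈ : ∀ {R v T} → Grown R v T → v ∈ T
  root∈ root               = here refl
  root∈ (grow grown _ _ _ _) = there (root∈ grown)

  grown-unique : ∀ {R v T} → Grown R v T → Unique T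
  grown-unique root                   = [] ∷ []
  grown-unique (grow grown _ _ _ w∉X) = ¬Any⇒All¬ _ w∉X ∷ grown-unique grown

  grown-⊆ : ∀ {R v T} (Φ : Fin n → Set) → Φ v →
    (∀ {u w} → Φ u → adj G u w ≡ true → R u w ≡ true → Φ w) →
    Grown R v T → ∀ {x} → x ∈ T → Φ x
  grown-⊆ Φ Φv step root                        (here refl) = Φv
  grown-⊆ Φ Φv step (grow grown u∈X uw Ruw _)   (here refl) = step (grown-⊆ Φ Φv step grown u∈X) uw Ruw
  grown-⊆ Φ Φv step (grow grown _ _ _ _)        (there x∈X) = grown-⊆ Φ Φv step grown x∈X

  grown-∈-sequences : ∀ {R v T} → Grown R v T → ∃[ i ] (length T ≡ suc i × T ∈ sequences i)
  grown-∈-sequences {v = v} root = 0 , refl , ∈-map⁺ [_] (∈-allFin v)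
  grown-∈-sequences (grow {X} {u} {w} grown u∈X uw _ w∉X) with grown-∈-sequences grown
  ... | i , len , X∈ = suc i , cong suc len ,
    ∈-concatMap⁺ _ (lose X∈ (∈-concatMap⁺ _ (lose u∈X
      (∈-map⁺ (_∷ X) (∈-filter⁺ (λ w → ¬? (w ∈? X)) (∈-neighbours uw) w∉X)))))

  data Outcome (R : Relation) (v : Fin n) (N : ℕ) : Bool → Set where
    large  : ∀ {T} → Grown R v T → length T ≡ N → Outcome R v N true
    closed : ∀ {T} → Grown R v T → Closed R T → length T < N → Outcome R v N false

  -- The last hypothesis is the search invariant: an `R`-edge from a found vertex ends in a found
  -- vertex or still waits in `Q`. Once `Q` is empty it says that `X` is closed.
  explore-outcome : ∀ R v r X Q → Grown R v X →
    All (λ e → proj₁ e ∈ X × adj G (proj₁ e) (proj₂ e) ≡ true) Q →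
    (∀ {u w} → u ∈ X → adj G u w ≡ true → R u w ≡ true → w ∈ X ⊎ (u , w) ∈ Q) →
    Outcome R v (length X + r) (explore R r X Q)
  explore-outcome R v zero    X Q  grown _ _ = large grown (sym (+-identityʳ _))
  explore-outcome R v (suc r) X [] grown _ pending =
    closed grown (λ u∈ uw Ruw → [ id , (λ ()) ]′ (pending u∈ uw Ruw)) (m<m+n _ z<s)
  explore-outcome R v (suc r) X ((u , w) ∷ Q) grown ((u∈X , uw) ∷ Q-ok) pending
    with w ∈? X | R u w in Ruw
  ... | yes w∈X | _     = explore-outcome R v (suc r) X Q grown Q-ok pending′
    where
    pending′ : ∀ {x y} → x ∈ X → adj G x y ≡ true → R x y ≡ true → y ∈ X ⊎ (x , y) ∈ Q
    pending′ x∈ xy Rxy with pending x∈ xy Rxy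
    ... | inj₁ y∈          = inj₁ y∈
    ... | inj₂ (here refl) = inj₁ w∈X
    ... | inj₂ (there q)   = inj₂ q
  ... | no  _   | false = explore-outcome R v (suc r) X Q grown Q-ok pending′
    where
    pending′ : ∀ {x y} → x ∈ X → adj G x y ≡ true → R x y ≡ true → y ∈ X ⊎ (x , y) ∈ Q
    pending′ x∈ xy Rxy with pending x∈ xy Rxy
    ... | inj₁ y∈          = inj₁ y∈
    ... | inj₂ (here refl) = contradiction (trans (sym Ruw) Rxy) λ ()
    ... | inj₂ (there q)   = inj₂ q
  ... | no w∉X | true = subst (λ N → Outcome R v N (explore R r (w ∷ X) (Q ++ edges w))) (sym (+-suc (length X) r))
    (explore-outcome R v r (w ∷ X) (Q ++ edges w) (grow grown u∈X uw Ruw w∉X)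
      (++⁺ (All.map (λ (x∈ , xy) → there x∈ , xy) Q-ok) (edges-ok w (here refl))) pending′)
    where
    edges-ok : ∀ x {Y} → x ∈ Y → All (λ e → proj₁ e ∈ Y × adj G (proj₁ e) (proj₂ e) ≡ true) (edges x)
    edges-ok x x∈Y = map⁺ (All.tabulate (λ {y} y∈ → x∈Y , proj₂ (∈-filter⁻ (λ u → adj G x u Bool.≟ true) {xs = allFin n} y∈)))
    pending′ : ∀ {x y} → x ∈ w ∷ X → adj G x y ≡ true → R x y ≡ true → y ∈ w ∷ X ⊎ (x , y) ∈ Q ++ edges w
    pending′ (here refl) xy _ = inj₂ (∈-++⁺ʳ Q (∈-map⁺ (w ,_) (∈-neighbours xy)))
    pending′ (there x∈) xy Rxy with pending x∈ xy Rxy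
    ... | inj₁ y∈          = inj₁ (there y∈)
    ... | inj₂ (here refl) = inj₁ (here refl)
    ... | inj₂ (there q)   = inj₂ (∈-++⁺ˡ q)

  explore-from : ∀ R v r → Outcome R v (suc r) (explore R r [ v ] (edges v))
  explore-from R v r = explore-outcome R v r [ v ] (edges v) root
    (map⁺ (All.tabulate (λ {y} y∈ → here refl , proj₂ (∈-filter⁻ (λ u → adj G v u Bool.≟ true) {xs = allFin n} y∈))))
    (λ { (here refl) vw _ → inj₂ (∈-map⁺ (v ,_) (∈-neighbours vw)) })

  closed-set : ∀ {R v N b} → Outcome R v N b → b ≡ false → ∃[ T ] (Grown R v T × Closed R T × length T < N)
  closed-set (closed grown cl len) _ = _ , grown , cl , len

  module _ {m : ℕ} (L : Vec (Subset m) n) where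

    _∈L_ : Fin m → Fin n → Set
    c ∈L v = lookup (lookup L v) c ≡ true

    ColourableOn : List (Fin n) → Set
    ColourableOn S = Σ (Fin n → Fin m) λ c → ((∀ {v} → v ∈ S → c v ∈L v) ×
      (∀ {u v} → u ∈ S → v ∈ S → adj G u v ≡ true → c u ≢ c v))

    conflict-true : ∀ {u v c} → c ∈L u → c ∈L v → conflict L u v ≡ true
    conflict-true {u} {v} {c} cu cv = any-true (λ c → lookup (lookup L u) c ∧ lookup (lookup L v) c) (∈-allFin c) (cong₂ _∧_ cu cv)

    induced : List (Fin n) → ∃[ h ] Graph h
    induced T = length T , record
      { adj = λ i j → adj G (List.lookup T i) (List.lookup T j)
      ; sym = λ i j → Graph.sym G (List.lookup T i) (List.lookup T j)
      ; irr = λ i → irr G (List.lookup T i) }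

    module _ (k : ℕ) .{{_ : NonZero k}} (L-card : ∀ v → ∣ lookup L v ∣ ≡ k) where

      pick : Fin n → Fin m
      pick v = proj₁ (nonempty (lookup L v) (λ eq → ≢-nonZero⁻¹ k (trans (sym (L-card v)) eq)))

      choose : ∀ T → Choosable k (proj₂ (induced T)) → ColourableOn T
      choose T choosable with choosable m (λ i → lookup L (List.lookup T i)) (λ i → L-card (List.lookup T i))
      ... | c , c∈ , c-proper = c′ , c′∈ , c′-proper
        where
        c′ : Fin n → Fin m
        c′ v with v ∈? T
        ... | yes v∈T = c (index v∈T)
        -- A default outside `T`, where nothing is required; lists are nonempty, so a colour is at
        -- hand.
        ... | no  _   = pick v
        at : ∀ {v} → v ∈ T → ∃[ i ] (List.lookup T i ≡ v × c′ v ≡ c i)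
        at {v} v∈T with v ∈? T
        ... | yes v∈T′ = index v∈T′ , sym (lookup-index v∈T′) , refl
        ... | no  v∉T  = contradiction v∈T v∉T
        c′∈ : ∀ {v} → v ∈ T → c′ v ∈L v
        c′∈ v∈T with at v∈T
        ... | i , refl , eq = trans (cong (lookup (lookup L (List.lookup T i))) eq) ([]=⇒lookup (c∈ i))
        c′-proper : ∀ {u v} → u ∈ T → v ∈ T → adj G u v ≡ true → c′ u ≢ c′ v
        c′-proper u∈T v∈T uv eq with at u∈T | at v∈T
        ... | i , refl , eqi | j , refl , eqj = c-proper i j uv (trans (sym eqi) (trans eq eqj))

      Isolated : List (Fin n) → Fin n → Fin m → Set
      Isolated T u c = c ∈L u × ¬ Any.Any (λ w → adj G u w ≡ true × c ∈L w) T

      extend : ∀ T {u c} → Isolated T u c → ColourableOn (filter (λ w → ¬? (w Fin.≟ u)) T) → ColourableOn T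
      extend T {u} {c} (c∈u , isolated) (f , f∈ , f-proper) = f′ , f′∈ , f′-proper
        where
        remains : ∀ {v} → v ∈ T → v ≢ u → v ∈ filter (λ w → ¬? (w Fin.≟ u)) T
        remains = ∈-filter⁺ (λ w → ¬? (w Fin.≟ u))
        f′ : Fin n → Fin m
        f′ v with v Fin.≟ u
        ... | yes _ = c
        ... | no  _ = f v
        f′∈ : ∀ {v} → v ∈ T → f′ v ∈L v
        f′∈ {v} v∈T with v Fin.≟ u
        ... | yes refl = c∈u
        ... | no  v≢u  = f∈ (remains v∈T v≢u)
        f′-proper : ∀ {v w} → v ∈ T → w ∈ T → adj G v w ≡ true → f′ v ≢ f′ w
        f′-proper {v} {w} v∈T w∈T vw eq with v Fin.≟ u | w Fin.≟ u
        ... | yes refl | yes refl = contradiction (trans (sym vw) (irr G v)) λ ()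
        ... | yes refl | no  w≢u  = isolated (lose w∈T (vw , trans (cong (lookup (lookup L w)) eq) (f∈ (remains w∈T w≢u))))
        ... | no  v≢u  | yes refl = isolated (lose v∈T
          (trans (Graph.sym G w v) vw , trans (cong (lookup (lookup L v)) (sym eq)) (f∈ (remains v∈T v≢u))))
        ... | no  v≢u  | no  w≢u  = f-proper (remains v∈T v≢u) (remains w∈T w≢u) vw eq

      glue : ∀ S T → (∀ {u w} → u ∈ T → w ∈ S → adj G u w ≡ true → conflict L u w ≡ true → w ∈ T) →
        ColourableOn T → ColourableOn (filter (λ w → ¬? (w ∈? T)) S) → ColourableOn S
      glue S T sealed (f , f∈ , f-proper) (h , h∈ , h-proper) = c , c∈ , c-proper
        where
        outside : ∀ {v} → v ∈ S → v ∉ T → v ∈ filter (λ w → ¬? (w ∈? T)) S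
        outside = ∈-filter⁺ (λ w → ¬? (w ∈? T))
        c : Fin n → Fin m
        c v with v ∈? T
        ... | yes _ = f v
        ... | no  _ = h v
        c∈ : ∀ {v} → v ∈ S → c v ∈L v
        c∈ {v} v∈S with v ∈? T
        ... | yes v∈T = f∈ v∈T
        ... | no  v∉T = h∈ (outside v∈S v∉T)
        c-proper : ∀ {u v} → u ∈ S → v ∈ S → adj G u v ≡ true → c u ≢ c v
        c-proper {u} {v} u∈S v∈S uv eq with u ∈? T | v ∈? T
        ... | yes u∈T | yes v∈T = f-proper u∈T v∈T uv eq
        ... | no  u∉T | no  v∉T = h-proper (outside u∈S u∉T) (outside v∈S v∉T) uv eq
        ... | yes u∈T | no  v∉T = v∉T (sealed u∈T v∈S uv
          (conflict-true (f∈ u∈T) (trans (cong (lookup (lookup L v)) eq) (h∈ (outside v∈S v∉T)))))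
        ... | no  u∉T | yes v∈T = u∉T (sealed v∈T u∈S (trans (Graph.sym G v u) uv)
          (conflict-true (f∈ v∈T) (trans (cong (lookup (lookup L u)) (sym eq)) (h∈ (outside u∈S u∉T)))))

      palette : List (Fin n) → Subset m
      palette T = tabulate (λ c → any (λ u → lookup (lookup L u) c) T)

      -- If no colour is isolated, every colour of the palette is used by two lists.
      palette-small : ∀ T → (∀ {u c} → u ∈ T → ¬ Isolated T u c) → 2 * ∣ palette T ∣ ≤ k * length T
      palette-small T crowded = begin
        2 * ∣ palette T ∣
          ≡⟨ cong (2 *_) (card≡∑ (palette T)) ⟩
        2 * ∑[ c ∈ allFin m ] ⟦ lookup (palette T) c ⟧
          ≡⟨ sym (∑-*ˡ 2 _ (allFin m)) ⟩
        ∑[ c ∈ allFin m ] (2 * ⟦ lookup (palette T) c ⟧)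
          ≤⟨ ∑-mono (allFin m) twice ⟩
        ∑[ c ∈ allFin m ] ∑[ u ∈ T ] ⟦ lookup (lookup L u) c ⟧
          ≡⟨ ∑-swap _ (allFin m) T ⟩
        ∑[ u ∈ T ] ∑[ c ∈ allFin m ] ⟦ lookup (lookup L u) c ⟧
          ≡⟨ ∑-cong (λ u → trans (sym (card≡∑ (lookup L u))) (L-card u)) T ⟩
        ∑[ u ∈ T ] k
          ≡⟨ trans (∑-const k T) (*-comm (length T) k) ⟩
        k * length T ∎
        where
        open ≤-Reasoning
        1≤⟦⟧ : ∀ {b} → b ≡ true → 1 ≤ ⟦ b ⟧
        1≤⟦⟧ refl = ≤-refl
        twice : ∀ c → 2 * ⟦ lookup (palette T) c ⟧ ≤ ∑[ u ∈ T ] ⟦ lookup (lookup L u) c ⟧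
        twice c rewrite lookup∘tabulate (λ c → any (λ u → lookup (lookup L u) c) T) c
          with any (λ u → lookup (lookup L u) c) T in eq
        ... | false = z≤n
        ... | true  with any-true⁻ (λ u → lookup (lookup L u) c) T eq
        ...   | u , u∈T , c∈u with Any.any? (λ w → (adj G u w Bool.≟ true) ×-dec (lookup (lookup L w) c Bool.≟ true)) T
        ...     | no  isolated = contradiction (c∈u , isolated) (crowded u∈T)
        ...     | yes shared with find shared
        ...       | w , w∈T , uw , c∈w = 2≤∑ (λ u → ⟦ lookup (lookup L u) c ⟧) u∈T w∈T
          (λ { refl → contradiction (trans (sym uw) (irr G u)) λ () }) (1≤⟦⟧ c∈u) (1≤⟦⟧ c∈w)

      contained-palette : ∀ T → Counting.contained k m G (palette T) T L ≡ true
      contained-palette T = all-true _ T (λ {u} u∈T → ⊆ᵇ-true (lookup L u) (palette T) (λ c c∈u →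
        trans (lookup∘tabulate _ c) (any-true (λ u → lookup (lookup L u) c) u∈T c∈u)))

      isolated? : ∀ T → (∃[ u ] ∃[ c ] (u ∈ T × Isolated T u c)) ⊎ (∀ {u c} → u ∈ T → ¬ Isolated T u c)
      isolated? T with Any.any? (λ u → Fin.any? (λ c → (lookup (lookup L u) c Bool.≟ true) ×-dec
                    ¬? (Any.any? (λ w → (adj G u w Bool.≟ true) ×-dec (lookup (lookup L w) c Bool.≟ true)) T))) T
      ... | no  none = inj₂ (λ u∈T iso → none (lose u∈T (_ , iso)))
      ... | yes some with find some
      ...   | u , u∈T , c , iso = inj₁ (u , c , u∈T , iso)

      module _ (g r : ℕ)
        (choosable : ∀ {h} (H : Graph h) → h ≤ g → H ⊆G G → Choosable k H)
        (no-large-component : ∀ v → explore (conflict L) r [ v ] (edges v) ≡ false)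
        (not-confined : ∀ i → g ≤ i → i < r → ∀ {X} → X ∈ sequences i →
          ∀ D → 2 * ∣ D ∣ ≤ k * suc i → Counting.contained k m G D X L ≢ true)
        where

        -- Deleting vertices can split a conflict component, so components are recomputed inside the
        -- set that remains to be coloured.
        within : List (Fin n) → Relation
        within S u w = conflict L u w ∧ does (w ∈? S)

        -- `N` bounds the number of vertices, and each round through the three functions loses at
        -- least one: `colour-closed` splits off the component of the head, and `colour-grown` sets
        -- aside a vertex with an isolated colour. What is left need not be a component, hence the
        -- return to `colour`.
        colour : ∀ N S → length S ≤ N → ColourableOn S
        colour-closed : ∀ N S → length S ≤ suc N → ∀ {v T} → v ∈ S →
          Grown (within S) v T → Closed (within S) T → length T ≤ r → ColourableOn S
        colour-grown : ∀ N {R v T} → length T ≤ suc N → Grown R v T → length T ≤ r → ColourableOn T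

        colour N       []       _ = pick , (λ ()) , (λ ())
        colour (suc N) S@(v ∷ _) S≤ with explore (within S) r [ v ] (edges v) | explore-from (within S) v r
        ... | false | closed grown cl (s≤s T≤r) = colour-closed N S S≤ (here refl) grown cl T≤r
        -- A set grown inside `S` stays within the full conflict component of `v`, which has at most
        -- `r` vertices, so `r + 1` of them cannot be found.
        ... | true  | large grown T≡ with closed-set (explore-from (conflict L) v r) (no-large-component v)
        ...   | T′ , grown′ , cl′ , T′≤r = contradiction
          (≤-trans (≤-reflexive (sym T≡)) (unique-⊆⇒length-≤ (grown-unique grown)
            (grown-⊆ (_∈ T′) (root∈ grown′) (λ u∈ uw Ruw → cl′ u∈ uw (proj₁ (∧-true Ruw))) grown)))
          (<⇒≱ T′≤r)

        colour-closed N S S≤ {v} {T} v∈S grown cl T≤r = glue S T sealed (colour-grown N T≤ grown T≤r)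
          (colour N _ (≤-pred (≤-trans (filter-notAll (λ w → ¬? (w ∈? T)) S (lose v∈S (λ v∉T → v∉T (root∈ grown)))) S≤)))
          where
          ∈-true : ∀ {w} → w ∈ S → does (w ∈? S) ≡ true
          ∈-true {w} w∈S with w ∈? S
          ... | yes _  = refl
          ... | no w∉S = contradiction w∈S w∉S
          true-∈ : ∀ {w} → does (w ∈? S) ≡ true → w ∈ S
          true-∈ {w} eq with w ∈? S
          ... | yes w∈S = w∈S
          sealed : ∀ {u w} → u ∈ T → w ∈ S → adj G u w ≡ true → conflict L u w ≡ true → w ∈ T
          sealed u∈T w∈S uw conf = cl u∈T uw (cong₂ _∧_ conf (∈-true w∈S))
          T≤ : length T ≤ suc N
          T≤ = ≤-trans (unique-⊆⇒length-≤ (grown-unique grown)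
            (grown-⊆ (_∈ S) v∈S (λ _ _ Ruw → true-∈ (proj₂ (∧-true Ruw))) grown)) S≤

        colour-grown N {T = T} T≤ grown T≤r with length T ≤? g
        ... | yes T≤g = choose T (choosable (proj₂ (induced T)) T≤g
          (List.lookup T , lookup-injective (grown-unique grown) , λ _ _ → id))
        ... | no  T≰g with isolated? T
        ...   | inj₁ (u , c , u∈T , iso) = extend T iso (colour N _
          (≤-pred (≤-trans (filter-notAll (λ w → ¬? (w Fin.≟ u)) T (lose u∈T (λ u≢u → u≢u refl))) T≤)))
        -- The index `i` is one less than the size of `T`, so size above `g` becomes `g ≤ i` and
        -- size at most `r` becomes `i < r`.
        ...   | inj₂ crowded with grown-∈-sequences grown
        ...     | i , len , T∈ = contradiction (contained-palette T)
          (not-confined i (≤-pred (≤-trans (≰⇒> T≰g) (≤-reflexive len))) (≤-trans (≤-reflexive (sym len)) T≤r) T∈ (palette T)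
            (≤-trans (palette-small T crowded) (≤-reflexive (cong (k *_) len))))

        colour-all : ColourableOn (allFin n)
        colour-all = colour _ (allFin n) ≤-refl

-- The enumeration of colour maps searched by colourableB is private to Defs, so it is
-- recovered by unification, one layer of its recursion at a time.

mutual
  respects : Graph (suc n) → Vec (Subset m) (suc n) → Vec (Fin m) (suc n) → Bool
  respects = _

  extensions : ∀ n m → Fin m → List (Vec (Fin m) (suc n))
  extensions = _

  colourableB-suc : (G : Graph (suc n)) (L : Vec (Subset m) (suc n)) →
    colourableB G L ≡ any (respects G L) (concatMap (extensions n m) (allFin m))
  colourableB-suc G L = refl

mutual
  colourMaps : ∀ n m → List (Vec (Fin m) n)
  colourMaps = _

  extensions≡ : ∀ n m c → extensions n m c ≡ map (c ∷_) (colourMaps n m)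
  extensions≡ n m c = refl

∈-colourMaps : (c : Vec (Fin m) n) → c ∈ colourMaps n m
∈-colourMaps []      = here refl
∈-colourMaps (c ∷ cs) = ∈-concatMap⁺ _ (lose (∈-allFin c) (∈-map⁺ (c ∷_) (∈-colourMaps cs)))

-- Bad assignments are those that the Boolean test rejects; bounding their number from above calls
-- for acceptance as soon as a colouring exists.
colourableB-complete : ∀ (G : Graph n) (L : Vec (Subset m) n) (c : Fin n → Fin m) →
  (∀ v → lookup (lookup L v) (c v) ≡ true) → (∀ u v → adj G u v ≡ true → c u ≢ c v) →
  colourableB G L ≡ true
colourableB-complete {zero}  G L c c∈ proper = refl
colourableB-complete {suc n} G L c c∈ proper =
  any-true (respects G L) {x = tabulate c} {xs = colourMaps (suc n) _} (∈-colourMaps (tabulate c))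
    (all-true _ (allFin (suc n)) (λ {v} _ → cong₂ _∧_
      (trans (cong (lookup (lookup L v)) (lookup∘tabulate c v)) (c∈ v))
      (all-true _ (allFin (suc n)) (λ {u} _ → separated v u))))
  where
  separated : ∀ v u → not (adj G v u) ∨ not ⌊ lookup (tabulate c) v Fin.≟ lookup (tabulate c) u ⌋ ≡ true
  separated v u with adj G v u in vu
  ... | false = refl
  ... | true  with lookup (tabulate c) v Fin.≟ lookup (tabulate c) u
  ...   | no  _  = refl
  ...   | yes eq = contradiction (trans (sym (lookup∘tabulate c v)) (trans eq (lookup∘tabulate c u))) (proper v u vu)

-- From obstructions to the number of bad assignments

∈-allVecs : (s : Subset m) → s ∈ allVecs m
∈-allVecs []          = here refl
∈-allVecs (true ∷ s)  = ∈-concatMap⁺ _ (lose (∈-allVecs s) (here refl))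
∈-allVecs (false ∷ s) = ∈-concatMap⁺ _ (lose (∈-allVecs s) (there (here refl)))

⟦⟧≡0 : ∀ {b} → ⟦ b ⟧ ≤ 0 → b ≡ false
⟦⟧≡0 {false} _ = refl

module BadCount (k m : ℕ) .{{_ : NonZero k}} {n : ℕ} (G : Graph n) where

  open Assignments k m
  open Exploration G
  open Counting k m G
  open Colouring G

  -- The first-moment method: `f` takes natural values and is at least 1 wherever the colouring
  -- fails, so it dominates the indicator of a bad assignment.
  badCount-≤ : (f : Vec (Subset m) n → ℕ) →
    (∀ {L} → (∀ v → ∣ lookup L v ∣ ≡ k) → f L ≤ 0 → ColourableOn L (allFin n)) →
    badCount k m G ≤ ∑ (assignments n) f
  badCount-≤ f colour = begin
    badCount k m G
      ≡⟨ length≡∑ (filter (λ L → colourableB G L Bool.≟ false) (assignments n)) ⟩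
    ∑[ L ∈ filter (λ L → colourableB G L Bool.≟ false) (assignments n) ] 1
      ≡⟨ ∑-filter (λ L → colourableB G L Bool.≟ false) (λ _ → 1) (assignments n) ⟩
    ∑[ L ∈ assignments n ] (⟦ does (colourableB G L Bool.≟ false) ⟧ * 1)
      ≤⟨ ∑-mono-∈ (assignments n) bad ⟩
    ∑ (assignments n) f ∎
    where
    open ≤-Reasoning
    bad : ∀ {L} → L ∈ assignments n → ⟦ does (colourableB G L Bool.≟ false) ⟧ * 1 ≤ f L
    bad {L} L∈ with f L in eq
    ... | suc _ = ≤-trans (≤-trans (≤-reflexive (*-identityʳ _)) (⟦⟧≤1 (does (colourableB G L Bool.≟ false)))) (s≤s z≤n)
    ... | zero  with colour (∈-assignments⇒card L∈) (≤-reflexive eq)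
    ...   | c , c∈ , proper
      rewrite colourableB-complete G L c (λ v → c∈ (∈-allFin v)) (λ u v → proper (∈-allFin u) (∈-allFin v)) = z≤n

  -- Members of `sequences i` have i + 1 vertices, so the sizes start at g + 1. Letting `t` run up
  -- to `r` instead of r - g avoids truncated subtraction; the surplus sizes only enlarge the count.
  obstructions : ℕ → ℕ → Vec (Subset m) n → ℕ
  obstructions g r L =
    ∑[ v ∈ allFin n ] ⟦ explore (conflict L) r [ v ] (edges v) ⟧ +
    ∑[ t ∈ upTo r ] confined ⌊ k * suc (g + t) /2⌋ (g + t) L

  obstruction-free⇒colourable : ∀ g r →
    (∀ {h} (H : Graph h) → h ≤ g → H ⊆G G → Choosable k H) →
    ∀ {L} → (∀ v → ∣ lookup L v ∣ ≡ k) → obstructions g r L ≤ 0 → ColourableOn L (allFin n)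
  obstruction-free⇒colourable g r choosable {L} L-card none =
    colour-all L k L-card g r choosable no-large-component not-confined
    where
    no-large-component : ∀ v → explore (conflict L) r [ v ] (edges v) ≡ false
    no-large-component v = ⟦⟧≡0 (≤-trans (f≤∑ _ (∈-allFin v)) (≤-trans (m≤m+n _ _) none))

    not-confined : ∀ i → g ≤ i → i < r → ∀ {X} → X ∈ sequences i →
      ∀ D → 2 * ∣ D ∣ ≤ k * suc i → contained D X L ≢ true
    not-confined i g≤i i<r {X} X∈ D 2D≤ is-contained = 1+n≰n (begin
      1
        ≡⟨ cong₂ (λ a b → ⟦ a ⟧ * ⟦ b ⟧) (sym (≤ᵇ-true D≤)) (sym is-contained) ⟩
      ⟦ ∣ D ∣ ≤ᵇ ⌊ k * suc i /2⌋ ⟧ * ⟦ contained D X L ⟧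
        ≤⟨ f≤∑ (λ D → ⟦ ∣ D ∣ ≤ᵇ ⌊ k * suc i /2⌋ ⟧ * ⟦ contained D X L ⟧) (∈-allVecs D) ⟩
      ∑[ D ∈ allVecs m ] (⟦ ∣ D ∣ ≤ᵇ ⌊ k * suc i /2⌋ ⟧ * ⟦ contained D X L ⟧)
        ≤⟨ f≤∑ (λ X → ∑[ D ∈ allVecs m ] (⟦ ∣ D ∣ ≤ᵇ ⌊ k * suc i /2⌋ ⟧ * ⟦ contained D X L ⟧)) X∈ ⟩
      confined ⌊ k * suc i /2⌋ i L
        ≡⟨ cong (λ i → confined ⌊ k * suc i /2⌋ i L) (sym (m+[n∸m]≡n g≤i)) ⟩
      confined ⌊ k * suc (g + (i ∸ g)) /2⌋ (g + (i ∸ g)) L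
        ≤⟨ f≤∑ (λ t → confined ⌊ k * suc (g + t) /2⌋ (g + t) L) (∈-upTo⁺ (≤-<-trans (m∸n≤m i g) i<r)) ⟩
      ∑[ t ∈ upTo r ] confined ⌊ k * suc (g + t) /2⌋ (g + t) L
        ≤⟨ ≤-trans (m≤n+m _ _) none ⟩
      0 ∎)
      where
      open ≤-Reasoning
      D≤ : ∣ D ∣ ≤ ⌊ k * suc i /2⌋
      D≤ = ≤-trans (≤-reflexive (trans (n≡⌊n+n/2⌋ ∣ D ∣) (cong (λ x → ⌊ ∣ D ∣ + x /2⌋) (sym (+-identityʳ _)))))
        (⌊n/2⌋-mono 2D≤)
      ≤ᵇ-true : ∀ {a b} → a ≤ b → (a ≤ᵇ b) ≡ true
      ≤ᵇ-true {a} {b} a≤b with a ≤ᵇ b | ≤⇒≤ᵇ a≤b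
      ... | true | _ = refl

  edgeless⇒badCount≡0 : (∀ u v → adj G u v ≢ true) → badCount k m G ≡ 0
  edgeless⇒badCount≡0 edgeless = n≤0⇒n≡0 (≤-trans
    (badCount-≤ (λ _ → 0) (λ {L} L-card _ →
      pick L k L-card , (λ {v} _ → proj₂ (nonempty (lookup L v) _)) , λ _ _ uv _ → edgeless _ _ uv))
    (≤-reflexive (∑-zero (assignments n))))

  badCount-bound : ∀ g r → (∀ {h} (H : Graph h) → h ≤ g → H ⊆G G → Choosable k H) →
    badCount k m G ≤
      ∑[ v ∈ allFin n ] count (λ L → explore (conflict L) r [ v ] (edges v)) +
      ∑[ t ∈ upTo r ] ∑[ L ∈ assignments n ] confined ⌊ k * suc (g + t) /2⌋ (g + t) L
  badCount-bound g r choosable = ≤-trans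
    (badCount-≤ (obstructions g r) (λ {L} → obstruction-free⇒colourable g r choosable {L}))
    (≤-reflexive (trans (∑-+ _ _ (assignments n))
      (cong₂ _+_ (∑-swap _ (assignments n) (allFin n)) (∑-swap _ (assignments n) (upTo r)))))

-- Elementary inequalities

^-distribʳ-* : ∀ e a b → (a * b) ^ e ≡ a ^ e * b ^ e
^-distribʳ-* zero    a b = refl
^-distribʳ-* (suc e) a b = trans (cong (a * b *_) (^-distribʳ-* e a b)) (interchange a b (a ^ e) (b ^ e))

-- Bernoulli's inequality for (1 + 1/N)^(n+1), multiplied by N^(n+1) to stay within the naturals.
bernoulli : ∀ N n → N ^ suc n + suc n * N ^ n ≤ suc N ^ suc n
bernoulli N zero    = ≤-reflexive (+-comm (N * 1) 1)
bernoulli N (suc n) = begin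
  N ^ suc (suc n) + suc (suc n) * N ^ suc n
    ≤⟨ m≤m+n _ (suc n * N ^ n) ⟩
  N ^ suc (suc n) + suc (suc n) * N ^ suc n + suc n * N ^ n
    ≡⟨ expand N n (N ^ n) ⟩
  suc N * (N ^ suc n + suc n * N ^ n)
    ≤⟨ *-monoʳ-≤ (suc N) (bernoulli N n) ⟩
  suc N ^ suc (suc n) ∎
  where
  open ≤-Reasoning
  expand : ∀ N n x → N * (N * x) + suc (suc n) * (N * x) + suc n * x ≡ suc N * (N * x + suc n * x)
  expand = solve-∀

-- (1 + 1/n)^(n+1) is decreasing in n.
ratio-decreasing : ∀ n → suc (suc n) ^ suc (suc n) * n ^ suc n ≤ suc n ^ suc n * suc n ^ suc (suc n)
ratio-decreasing n = begin
  suc (suc n) ^ suc (suc n) * n ^ suc n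
    ≡⟨ *-assoc (suc (suc n)) (suc (suc n) ^ suc n) _ ⟩
  suc (suc n) * (suc (suc n) ^ suc n * n ^ suc n)
    ≡⟨ cong (suc (suc n) *_) (sym (^-distribʳ-* (suc n) (suc (suc n)) n)) ⟩
  suc (suc n) * (N * N ^ n)
    ≤⟨ m≤m+n _ (N ^ n) ⟩
  suc (suc n) * (N * N ^ n) + N ^ n
    ≡⟨ expand n (N ^ n) ⟩
  suc n * (N * N ^ n + suc n * N ^ n)
    ≤⟨ *-monoʳ-≤ (suc n) (bernoulli N n) ⟩
  suc n * suc N ^ suc n
    ≡⟨ cong (λ x → suc n * x ^ suc n) (square n) ⟩
  suc n * (suc n * suc n) ^ suc n
    ≡⟨ cong (suc n *_) (^-distribʳ-* (suc n) (suc n) (suc n)) ⟩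
  suc n * (suc n ^ suc n * suc n ^ suc n)
    ≡⟨ x∙yz≈y∙xz (suc n) (suc n ^ suc n) _ ⟩
  suc n ^ suc n * suc n ^ suc (suc n) ∎
  where
  open ≤-Reasoning
  -- Since (n+1)² = n(n+2) + 1, Bernoulli's inequality at this `N` compares (n(n+2))^(n+1) with
  -- (n+1)^(2n+2).
  N = suc (suc n) * n
  expand : ∀ n x → suc (suc n) * (suc (suc n) * n * x) + x ≡ suc n * (suc (suc n) * n * x + suc n * x)
  expand = solve-∀
  square : ∀ n → suc (suc (suc n) * n) ≡ suc n * suc n
  square = solve-∀

-- 8 is the least n at which (1 + 1/n)^(n+1) has come down to 2.9: it is about 2.887 there and about
-- 2.910 at 7. From 8 on, monotonicity carries the bound upwards.
ratio-bound : ∀ {n} → 8 ≤′ n → 10 * suc n ^ suc n ≤ 29 * n ^ suc n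
ratio-bound (≤′-reflexive refl) = ≤ᵇ⇒≤ _ _ _
ratio-bound (≤′-step {n} 8≤n) = *-cancelʳ-≤ _ _ (n ^ suc n) {{m^n≢0 n (suc n) {{>-nonZero (<-≤-trans z<s (≤′⇒≤ 8≤n))}}}} (begin
  10 * suc (suc n) ^ suc (suc n) * n ^ suc n    ≡⟨ *-assoc 10 (suc (suc n) ^ suc (suc n)) _ ⟩
  10 * (suc (suc n) ^ suc (suc n) * n ^ suc n)  ≤⟨ *-monoʳ-≤ 10 (ratio-decreasing n) ⟩
  10 * (suc n ^ suc n * suc n ^ suc (suc n))    ≡⟨ sym (*-assoc 10 (suc n ^ suc n) _) ⟩
  10 * suc n ^ suc n * suc n ^ suc (suc n)      ≤⟨ *-monoˡ-≤ (suc n ^ suc (suc n)) (ratio-bound 8≤n) ⟩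
  29 * n ^ suc n * suc n ^ suc (suc n)          ≡⟨ xy∙z≈xz∙y 29 (n ^ suc n) _ ⟩
  29 * suc n ^ suc (suc n) * n ^ suc n          ∎)
  where open ≤-Reasoning

-- (1 + 1/n)^n ≤ 29/10 < 3.
e-bound : ∀ n → 10 * suc n ^ n ≤ 29 * n ^ n
e-bound 0 = ≤ᵇ⇒≤ _ _ _
e-bound 1 = ≤ᵇ⇒≤ _ _ _
e-bound 2 = ≤ᵇ⇒≤ _ _ _
e-bound 3 = ≤ᵇ⇒≤ _ _ _
e-bound 4 = ≤ᵇ⇒≤ _ _ _
e-bound 5 = ≤ᵇ⇒≤ _ _ _
e-bound 6 = ≤ᵇ⇒≤ _ _ _
e-bound 7 = ≤ᵇ⇒≤ _ _ _
-- The sequence (1 + 1/n)^n increases, so induction on it gives no upper bound; it is compared with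
-- the decreasing (1 + 1/n)^(n+1), which is small enough only from 8 on.
e-bound (suc (suc (suc (suc (suc (suc (suc (suc j)))))))) = beyond (8 + j) (m≤m+n 8 j)
  where
  open ≤-Reasoning
  beyond : ∀ n → 8 ≤ n → 10 * suc n ^ n ≤ 29 * n ^ n
  beyond n@(suc _) 8≤n = *-cancelˡ-≤ n (begin
    n * (10 * suc n ^ n)     ≤⟨ *-monoˡ-≤ (10 * suc n ^ n) (n≤1+n n) ⟩
    suc n * (10 * suc n ^ n) ≡⟨ x∙yz≈y∙xz (suc n) 10 (suc n ^ n) ⟩
    10 * suc n ^ suc n       ≤⟨ ratio-bound (≤⇒≤′ 8≤n) ⟩
    29 * n ^ suc n           ≡⟨ x∙yz≈y∙xz 29 n (n ^ n) ⟩
    n * (29 * n ^ n)         ∎)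

n≤2^n : ∀ n → n ≤ 2 ^ n
n≤2^n zero    = z≤n
n≤2^n (suc n) = ≤-trans (+-mono-≤ (m^n>0 2 n) (n≤2^n n)) (≤-reflexive (cong (2 ^ n +_) (sym (+-identityʳ _))))

log₂-bracket : ∀ x → ∃[ ℓ ] (suc x ≤ 2 ^ ℓ × 2 ^ ℓ ≤ 2 * suc x)
log₂-bracket zero = 0 , ≤-refl , s≤s z≤n
log₂-bracket (suc x) with log₂-bracket x
... | ℓ , lower , upper with suc (suc x) ≤? 2 ^ ℓ
...   | yes above = ℓ , above , ≤-trans upper (*-monoʳ-≤ 2 (n≤1+n (suc x)))
...   | no  below = suc ℓ , (begin
  suc (suc x)     ≤⟨ s≤s (m≤n+m (suc x) x) ⟩
  suc x + suc x   ≤⟨ +-mono-≤ lower lower ⟩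
  2 ^ ℓ + 2 ^ ℓ   ≡⟨ cong (2 ^ ℓ +_) (sym (+-identityʳ _)) ⟩
  2 * 2 ^ ℓ       ∎) , *-monoʳ-≤ 2 (<⇒≤ (≰⇒> below))
  where open ≤-Reasoning

-- With h = ⌊ℓ/2⌋, 2^ℓ is at least 2^h times 2^h: one factor pays for a single h, the other for the
-- remaining power by induction. The constant 3 comes from ℓ ≤ 2h + 1 ≤ 3h once h is positive.
2^-dominates : ∀ A C → ∃[ ℓ₀ ] ∀ ℓ → ℓ₀ ≤ ℓ → C * ℓ ^ A ≤ 2 ^ ℓ
2^-dominates zero C = C , λ ℓ C≤ℓ → ≤-trans (≤-reflexive (*-identityʳ C)) (≤-trans (n≤2^n C) (^-monoʳ-≤ 2 C≤ℓ))
2^-dominates (suc A) C with 2^-dominates A (C * 3 ^ suc A)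
... | ℓ₀ , dom = 2 * suc ℓ₀ , bound
  where
  open ≤-Reasoning
  bound : ∀ ℓ → 2 * suc ℓ₀ ≤ ℓ → C * ℓ ^ suc A ≤ 2 ^ ℓ
  bound ℓ large = begin
    C * ℓ ^ suc A               ≤⟨ *-monoʳ-≤ C (^-monoˡ-≤ (suc A) ℓ≤3h) ⟩
    C * (3 * h) ^ suc A         ≡⟨ cong (C *_) (^-distribʳ-* (suc A) 3 h) ⟩
    C * (3 ^ suc A * (h * h ^ A)) ≡⟨ regroup C (3 ^ suc A) h (h ^ A) ⟩
    C * 3 ^ suc A * h ^ A * h   ≤⟨ *-mono-≤ (dom h (<⇒≤ ℓ₀<h)) (n≤2^n h) ⟩
    2 ^ h * 2 ^ h               ≡⟨ sym (^-distribˡ-+-* 2 h h) ⟩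
    2 ^ (h + h)                 ≤⟨ ^-monoʳ-≤ 2 h+h≤ℓ ⟩
    2 ^ ℓ                       ∎
    where
    h = ⌊ ℓ /2⌋
    regroup : ∀ a b c d → a * (b * (c * d)) ≡ a * b * d * c
    regroup = solve-∀
    ⌈/2⌉≤ : ∀ n → ⌈ n /2⌉ ≤ suc ⌊ n /2⌋
    ⌈/2⌉≤ zero          = z≤n
    ⌈/2⌉≤ (suc zero)    = ≤-refl
    ⌈/2⌉≤ (suc (suc n)) = s≤s (⌈/2⌉≤ n)
    h+h≤ℓ : h + h ≤ ℓ
    h+h≤ℓ = ≤-trans (+-monoʳ-≤ h (⌊n/2⌋≤⌈n/2⌉ ℓ)) (≤-reflexive (⌊n/2⌋+⌈n/2⌉≡n ℓ))
    ℓ₀<h : ℓ₀ < h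
    ℓ₀<h = begin
      suc ℓ₀                       ≡⟨ n≡⌊n+n/2⌋ (suc ℓ₀) ⟩
      ⌊ suc ℓ₀ + suc ℓ₀ /2⌋        ≡⟨ cong (λ x → ⌊ suc ℓ₀ + x /2⌋) (sym (+-identityʳ _)) ⟩
      ⌊ 2 * suc ℓ₀ /2⌋             ≤⟨ ⌊n/2⌋-mono large ⟩
      h                            ∎
    ℓ≤3h : ℓ ≤ 3 * h
    ℓ≤3h = begin
      ℓ               ≡⟨ sym (⌊n/2⌋+⌈n/2⌉≡n ℓ) ⟩
      h + ⌈ ℓ /2⌉     ≤⟨ +-monoʳ-≤ h (⌈/2⌉≤ ℓ) ⟩
      h + suc h       ≤⟨ +-monoʳ-≤ h (+-monoˡ-≤ h (≤-trans (s≤s z≤n) ℓ₀<h)) ⟩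
      h + (h + h)     ≡⟨ cong (λ x → h + (h + x)) (sym (+-identityʳ h)) ⟩
      3 * h           ∎

^-cancelʳ-≤ : ∀ e {a b} .{{_ : NonZero e}} → a ^ e ≤ b ^ e → a ≤ b
^-cancelʳ-≤ e {a} {b} aᵉ≤bᵉ with a ≤? b
... | yes a≤b = a≤b
... | no  a≰b = contradiction aᵉ≤bᵉ (<⇒≱ (^-monoˡ-< e (≰⇒> a≰b)))

-- The terms are at most T/2, T/4, and so on. After doubling, the tail is the same statement for
-- `2 * f` with the same `T`, so no division occurs.
geometric-∑ : ∀ {T} (f : ℕ → ℕ) h r → (∀ t → t < r → 2 ^ suc t * f (h t) ≤ T) → ∑ (applyUpTo h r) f ≤ T
geometric-∑ f h zero    _  = z≤n
geometric-∑ {T} f h (suc r) f≤ = *-cancelˡ-≤ 2 (begin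
  2 * (f (h 0) + ∑ (applyUpTo (h ∘ suc) r) f)
    ≡⟨ *-distribˡ-+ 2 (f (h 0)) _ ⟩
  2 * f (h 0) + 2 * ∑ (applyUpTo (h ∘ suc) r) f
    ≡⟨ cong (2 * f (h 0) +_) (sym (∑-*ˡ 2 f (applyUpTo (h ∘ suc) r))) ⟩
  2 * f (h 0) + ∑[ t ∈ applyUpTo (h ∘ suc) r ] (2 * f t)
    ≤⟨ +-mono-≤ (f≤ 0 z<s) (geometric-∑ (λ t → 2 * f t) (h ∘ suc) r
         (λ t t<r → ≤-trans (≤-reflexive (regroup (2 ^ suc t) (f (h (suc t))))) (f≤ (suc t) (s<s t<r)))) ⟩
  T + T
    ≡⟨ cong (T +_) (sym (+-identityʳ T)) ⟩
  2 * T ∎)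
  where
  open ≤-Reasoning
  regroup : ∀ a b → a * (2 * b) ≡ 2 * a * b
  regroup = solve-∀

-- Numerical estimates for the two kinds of obstruction

-- By `e-bound`, (1 + 1/Δ)^((r+1)Δ) is at most (29/10)^(r+1); against 3^r this leaves
-- (29/10)(29/30)^r, here with denominators cleared.
explore-decay : ∀ Δ r c T .{{_ : NonZero Δ}} →
  c * (3 ^ r * Δ ^ (suc r * Δ)) ≤ suc Δ ^ (suc r * Δ) * T → c * (10 * 30 ^ r) ≤ 29 * 29 ^ r * T
explore-decay Δ r c T c≤ = *-cancelʳ-≤ _ _ E {{m^n≢0 Δ (suc r * Δ)}} (begin
  c * (10 * 30 ^ r) * E                  ≡⟨ cong (λ x → c * (10 * x) * E) (^-distribʳ-* r 3 10) ⟩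
  c * (10 * (3 ^ r * 10 ^ r)) * E        ≡⟨ regroup c (3 ^ r) (10 ^ r) E ⟩
  c * (3 ^ r * E) * (10 * 10 ^ r)        ≤⟨ *-monoˡ-≤ (10 ^ suc r) c≤ ⟩
  suc Δ ^ (suc r * Δ) * T * 10 ^ suc r   ≡⟨ xy∙z≈xz∙y (suc Δ ^ (suc r * Δ)) T _ ⟩
  suc Δ ^ (suc r * Δ) * 10 ^ suc r * T   ≤⟨ *-monoˡ-≤ T growth ⟩
  29 ^ suc r * E * T                     ≡⟨ xy∙z≈xz∙y (29 ^ suc r) E T ⟩
  29 * 29 ^ r * T * E                    ∎)
  where
  open ≤-Reasoning
  E = Δ ^ (suc r * Δ)
  regroup : ∀ a b c d → a * (10 * (b * c)) * d ≡ a * (b * d) * (10 * c)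
  regroup = solve-∀
  swap-exp : ∀ a → a ^ (suc r * Δ) ≡ (a ^ Δ) ^ suc r
  swap-exp a = trans (cong (a ^_) (*-comm (suc r) Δ)) (sym (^-*-assoc a Δ (suc r)))
  growth : suc Δ ^ (suc r * Δ) * 10 ^ suc r ≤ 29 ^ suc r * E
  growth = begin
    suc Δ ^ (suc r * Δ) * 10 ^ suc r    ≡⟨ cong (_* 10 ^ suc r) (swap-exp (suc Δ)) ⟩
    (suc Δ ^ Δ) ^ suc r * 10 ^ suc r    ≡⟨ *-comm ((suc Δ ^ Δ) ^ suc r) _ ⟩
    10 ^ suc r * (suc Δ ^ Δ) ^ suc r    ≡⟨ sym (^-distribʳ-* (suc r) 10 (suc Δ ^ Δ)) ⟩
    (10 * suc Δ ^ Δ) ^ suc r            ≤⟨ ^-monoˡ-≤ (suc r) (e-bound Δ) ⟩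
    (29 * Δ ^ Δ) ^ suc r                ≡⟨ ^-distribʳ-* (suc r) 29 (Δ ^ Δ) ⟩
    29 ^ suc r * (Δ ^ Δ) ^ suc r        ≡⟨ cong (29 ^ suc r *_) (sym (swap-exp Δ)) ⟩
    29 ^ suc r * E                      ∎

-- (1 + 1/29)^29 ≥ 2, so every 29 found vertices halve the probability. This is why the search
-- length is `29 * ℓ`.
30^-bound : ∀ ℓ → 2 ^ ℓ * 29 ^ (29 * ℓ) ≤ 30 ^ (29 * ℓ)
30^-bound ℓ = begin
  2 ^ ℓ * 29 ^ (29 * ℓ)   ≡⟨ cong (2 ^ ℓ *_) (sym (^-*-assoc 29 29 ℓ)) ⟩
  2 ^ ℓ * (29 ^ 29) ^ ℓ   ≡⟨ sym (^-distribʳ-* ℓ 2 (29 ^ 29)) ⟩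
  (2 * 29 ^ 29) ^ ℓ       ≤⟨ ^-monoˡ-≤ ℓ (≤ᵇ⇒≤ (2 * 29 ^ 29) (30 ^ 29) _) ⟩
  (30 ^ 29) ^ ℓ           ≡⟨ ^-*-assoc 30 29 ℓ ⟩
  30 ^ (29 * ℓ)           ∎
  where open ≤-Reasoning

large-component-rare : ∀ J n ℓ c T → 6 * J * n ≤ 2 ^ ℓ →
  c * (10 * 30 ^ (29 * ℓ)) ≤ 29 * 29 ^ (29 * ℓ) * T → n * (2 * J * c) ≤ T
large-component-rare J n ℓ c T ℓ-large c≤ = *-cancelˡ-≤ (29 * x) {{m^n≢0 29 (suc (29 * ℓ))}} (begin
  -- The 6 in `6 * J * n` is chosen here: 29 · 2 = 58 is at most 10 · 6 = 60, and the added term is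
  -- the difference.
  29 * x * (n * (2 * J * c))        ≤⟨ m≤m+n _ (2 * J * n * x * c) ⟩
  29 * x * (n * (2 * J * c)) + 2 * J * n * x * c ≡⟨ regroup x n J c ⟩
  c * (10 * (6 * J * n * x))        ≤⟨ *-monoʳ-≤ c (*-monoʳ-≤ 10 (*-monoˡ-≤ x ℓ-large)) ⟩
  c * (10 * (2 ^ ℓ * x))            ≤⟨ *-monoʳ-≤ c (*-monoʳ-≤ 10 (30^-bound ℓ)) ⟩
  c * (10 * 30 ^ (29 * ℓ))          ≤⟨ c≤ ⟩
  29 * x * T                        ∎)
  where
  open ≤-Reasoning
  x = 29 ^ (29 * ℓ)
  regroup : ∀ x n J c → 29 * x * (n * (2 * J * c)) + 2 * J * n * x * c ≡ c * (10 * (6 * J * n * x))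
  regroup = solve-∀

-- With s = g + 1 + t this is n² Δ^(2(s-1)) · O(s)^(O(s)) ≤ m^(ks). For t = 0 it is the hypothesis
-- on m; each further vertex costs a factor Δ² s^O(1), which m^k ≥ m³ absorbs.
expected-sets : ∀ k g J n m Δ r t → 3 ≤ k → .{{_ : NonZero J}} → .{{_ : NonZero m}} → Δ ≤ m →
  (4 * J * (k * suc g)) ^ (10 * (k * suc g)) * (n ^ 2 * Δ ^ (2 * g)) ≤ m ^ (k * suc g) →
  (4 * J * (k * (g + r))) ^ (10 * (k * (2 + g))) ≤ m → t < r →
  (4 * J * (k * suc (g + t))) ^ (10 * (k * suc (g + t))) * (n ^ 2 * Δ ^ (2 * (g + t))) ≤ m ^ (k * suc (g + t))
expected-sets k g J n m Δ r zero _ _ hyp _ _ = subst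
  (λ i → (4 * J * (k * suc i)) ^ (10 * (k * suc i)) * (n ^ 2 * Δ ^ (2 * i)) ≤ m ^ (k * suc i))
  (sym (+-identityʳ g)) hyp
expected-sets k@(suc _) g J n m Δ r t@(suc t′) 3≤k Δ≤m hyp m-large t<r = begin
  b ^ (10 * y) * (n ^ 2 * Δ ^ (2 * (g + t)))
    ≤⟨ *-mono-≤ sizes (≤-reflexive split-Δ) ⟩
  m ^ t * (n ^ 2 * Δ ^ (2 * g) * Δ ^ (2 * t))
    ≤⟨ *-monoʳ-≤ (m ^ t) (*-mono-≤ base (^-monoˡ-≤ (2 * t) Δ≤m)) ⟩
  m ^ t * (m ^ (k * suc g) * m ^ (2 * t))
    ≡⟨ x∙yz≈y∙xz (m ^ t) (m ^ (k * suc g)) _ ⟩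
  m ^ (k * suc g) * (m ^ t * m ^ (2 * t))
    ≡⟨ cong (m ^ (k * suc g) *_) (sym (^-distribˡ-+-* m t (2 * t))) ⟩
  m ^ (k * suc g) * m ^ (3 * t)
    ≤⟨ *-monoʳ-≤ (m ^ (k * suc g)) (^-monoʳ-≤ m (*-monoˡ-≤ t 3≤k)) ⟩
  m ^ (k * suc g) * m ^ (k * t)
    ≡⟨ sym (^-distribˡ-+-* m (k * suc g) (k * t)) ⟩
  m ^ (k * suc g + k * t)
    ≡⟨ cong (m ^_) (sym (*-distribˡ-+ k (suc g) t)) ⟩
  m ^ y ∎
  where
  open ≤-Reasoning
  y = k * suc (g + t)
  b = 4 * J * y
  β = 4 * J * (k * (g + r))

  b≤β : b ≤ β
  b≤β = *-monoʳ-≤ (4 * J) (*-monoʳ-≤ k (≤-trans (≤-reflexive (sym (+-suc g t))) (+-monoʳ-≤ g t<r)))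

  positive : ∀ z .{{_ : NonZero z}} → NonZero (4 * J * (k * z))
  positive z = m*n≢0 (4 * J) (k * z) {{m*n≢0 4 J}} {{m*n≢0 k z}}

  y≤ : y ≤ k * (2 + g) * t
  y≤ = begin
    k * suc (g + t)         ≡⟨ cong (k *_) (+-comm (suc g) t) ⟩
    k * (t + suc g)         ≤⟨ *-monoʳ-≤ k (+-monoʳ-≤ t (m≤m*n (suc g) t)) ⟩
    k * (t + suc g * t)     ≡⟨ sym (*-assoc k (2 + g) t) ⟩
    k * (2 + g) * t         ∎

  -- For t ≥ 1 the exponent is linear in `t` alone, so the combinatorial factor costs one `m` per
  -- further vertex. With Δ² ≤ m² this uses m³ per vertex, and `3≤k` provides m^k.
  sizes : b ^ (10 * y) ≤ m ^ t
  sizes = begin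
    b ^ (10 * y)                        ≤⟨ ^-monoʳ-≤ b {{positive (suc (g + t))}} (*-monoʳ-≤ 10 y≤) ⟩
    b ^ (10 * (k * (2 + g) * t))        ≤⟨ ^-monoˡ-≤ (10 * (k * (2 + g) * t)) b≤β ⟩
    β ^ (10 * (k * (2 + g) * t))        ≡⟨ cong (β ^_) (sym (*-assoc 10 (k * (2 + g)) t)) ⟩
    β ^ (10 * (k * (2 + g)) * t)        ≡⟨ sym (^-*-assoc β (10 * (k * (2 + g))) t) ⟩
    (β ^ (10 * (k * (2 + g)))) ^ t      ≤⟨ ^-monoˡ-≤ t m-large ⟩
    m ^ t                              ∎

  split-Δ : n ^ 2 * Δ ^ (2 * (g + t)) ≡ n ^ 2 * Δ ^ (2 * g) * Δ ^ (2 * t)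
  split-Δ = trans (cong (λ e → n ^ 2 * Δ ^ e) (*-distribˡ-+ 2 g t))
    (trans (cong (n ^ 2 *_) (^-distribˡ-+-* Δ (2 * g) (2 * t))) (sym (*-assoc (n ^ 2) _ (Δ ^ (2 * t)))))

  base : n ^ 2 * Δ ^ (2 * g) ≤ m ^ (k * suc g)
  base = ≤-trans (m≤n*m _ ((4 * J * (k * suc g)) ^ (10 * (k * suc g)))
    {{m^n≢0 (4 * J * (k * suc g)) (10 * (k * suc g)) {{positive (suc g)}}}}) hyp

-- Squaring both sides avoids the half-integer exponent ks/2.
weight-bound : ∀ k J n m Δ i t d → .{{_ : NonZero k}} → .{{_ : NonZero J}} → .{{_ : NonZero m}} → t ≤ i → 2 * d ≤ k * suc i →
  (4 * J * (k * suc i)) ^ (10 * (k * suc i)) * (n ^ 2 * Δ ^ (2 * i)) ≤ m ^ (k * suc i) →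
  2 ^ suc t * (2 * J) * (n * (i * Δ) ^ i * (suc m ^ d * (d ^ k) ^ suc i)) ≤ m ^ (k * suc i)
weight-bound k J n m Δ i t d t≤i 2d≤y few = ≤-trans crude (^-cancelʳ-≤ 2 (begin
  (b ^ (5 * y) * (n * Δ ^ i) * m ^ d) ^ 2
    ≡⟨ regroup (b ^ (5 * y)) n (Δ ^ i) (m ^ d) ⟩
  b ^ (5 * y) * b ^ (5 * y) * (n ^ 2 * (Δ ^ i * Δ ^ i)) * (m ^ d * m ^ d)
    ≡⟨ cong₂ (λ p q → p * (n ^ 2 * (Δ ^ i * Δ ^ i)) * q) (double b (5 * y)) (double m d) ⟩
  b ^ (2 * (5 * y)) * (n ^ 2 * (Δ ^ i * Δ ^ i)) * m ^ (2 * d)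
    ≡⟨ cong₂ (λ e p → b ^ e * (n ^ 2 * p) * m ^ (2 * d)) (sym (*-assoc 2 5 y)) (double Δ i) ⟩
  b ^ (10 * y) * (n ^ 2 * Δ ^ (2 * i)) * m ^ (2 * d)
    ≤⟨ *-mono-≤ few (^-monoʳ-≤ m 2d≤y) ⟩
  m ^ y * m ^ y
    ≡⟨ cong (m ^ y *_) (sym (*-identityʳ (m ^ y))) ⟩
  (m ^ y) ^ 2 ∎))
  where
  open ≤-Reasoning
  s = suc i
  y = k * s
  b = 4 * J * y

  instance
    J4≢0 : NonZero (4 * J)
    J4≢0 = m*n≢0 4 J
    y≢0 : NonZero y
    y≢0 = m*n≢0 k s
    b≢0 : NonZero b
    b≢0 = m*n≢0 (4 * J) y

  regroup : ∀ p n q e → p * (n * q) * e * (p * (n * q) * e * 1) ≡ p * p * (n * (n * 1) * (q * q)) * (e * e)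
  regroup = solve-∀

  double : ∀ a e → a ^ e * a ^ e ≡ a ^ (2 * e)
  double a e = trans (sym (^-distribˡ-+-* a e e)) (cong (λ x → a ^ (e + x)) (sym (+-identityʳ e)))

  s≤y : s ≤ y
  s≤y = m≤n*m s k
  d≤y : d ≤ y
  d≤y = ≤-trans (m≤m+n d (d + 0)) 2d≤y
  y≤b : y ≤ b
  y≤b = m≤n*m y (4 * J)
  2≤b : 2 ≤ b
  2≤b = ≤-trans (≤-trans (s≤s (s≤s z≤n)) (m≤m*n 4 J)) (m≤m*n (4 * J) y)
  2J≤b : 2 * J ≤ b
  2J≤b = ≤-trans (*-monoˡ-≤ J (≤ᵇ⇒≤ 2 4 _)) (m≤m*n (4 * J) y)
  m+1≤2m : suc m ≤ 2 * m
  m+1≤2m = ≤-trans (+-monoˡ-≤ m (>-nonZero⁻¹ m)) (≤-reflexive (cong (m +_) (sym (+-identityʳ m))))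

  W≤ : 2 ^ suc t * (2 * J) ≤ b ^ y * b ^ y
  W≤ = *-mono-≤ (≤-trans (^-monoˡ-≤ (suc t) 2≤b) (^-monoʳ-≤ b (≤-trans (s≤s t≤i) s≤y)))
    (≤-trans 2J≤b (≤-trans (≤-reflexive (sym (^-identityʳ b))) (^-monoʳ-≤ b (>-nonZero⁻¹ y))))
  sequences≤ : (i * Δ) ^ i ≤ b ^ y * Δ ^ i
  sequences≤ = ≤-trans (≤-reflexive (^-distribʳ-* i i Δ)) (*-monoˡ-≤ (Δ ^ i)
    (≤-trans (^-monoˡ-≤ i (≤-trans (n≤1+n i) (≤-trans s≤y y≤b))) (^-monoʳ-≤ b (≤-trans (n≤1+n i) s≤y))))
  colours≤ : suc m ^ d ≤ b ^ y * m ^ d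
  colours≤ = begin
    suc m ^ d       ≤⟨ ^-monoˡ-≤ d m+1≤2m ⟩
    (2 * m) ^ d     ≡⟨ ^-distribʳ-* d 2 m ⟩
    2 ^ d * m ^ d   ≤⟨ *-monoˡ-≤ (m ^ d) (≤-trans (^-monoˡ-≤ d 2≤b) (^-monoʳ-≤ b d≤y)) ⟩
    b ^ y * m ^ d   ∎
  lists≤ : (d ^ k) ^ s ≤ b ^ y
  lists≤ = ≤-trans (≤-reflexive (^-*-assoc d k s)) (^-monoˡ-≤ y (≤-trans d≤y y≤b))

  -- The base `b` exceeds 2, 2J, s and d at once. Two factors b^y come from the weights and one each
  -- from sequences, palettes and lists, hence 5y, which squaring turns into 10y.
  crude : 2 ^ suc t * (2 * J) * (n * (i * Δ) ^ i * (suc m ^ d * (d ^ k) ^ s)) ≤ b ^ (5 * y) * (n * Δ ^ i) * m ^ d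
  crude = begin
    2 ^ suc t * (2 * J) * (n * (i * Δ) ^ i * (suc m ^ d * (d ^ k) ^ s))
      ≤⟨ *-mono-≤ W≤ (*-mono-≤ (*-monoʳ-≤ n sequences≤) (*-mono-≤ colours≤ lists≤)) ⟩
    b ^ y * b ^ y * (n * (b ^ y * Δ ^ i) * (b ^ y * m ^ d * b ^ y))
      ≡⟨ collect (b ^ y) n (Δ ^ i) (m ^ d) ⟩
    (b ^ y) ^ 5 * (n * Δ ^ i) * m ^ d
      ≡⟨ cong (λ p → p * (n * Δ ^ i) * m ^ d) (trans (^-*-assoc b y 5) (cong (b ^_) (*-comm y 5))) ⟩
    b ^ (5 * y) * (n * Δ ^ i) * m ^ d ∎
    where
    collect : ∀ p n q e → p * p * (n * (p * q) * (p * e * p)) ≡ p * (p * (p * (p * (p * 1)))) * (n * q) * e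
    collect = solve-∀


-- The estimate for a single graph

module Instance (k g j : ℕ) (3≤k : 3 ≤ k) {n : ℕ} .{{_ : NonZero n}} (G : Graph n)
  (choosable : ∀ {h} (H : Graph h) → h ≤ g → H ⊆G G → Choosable k H)
  {Δ m : ℕ} .{{_ : NonZero Δ}} (deg : ∀ v → degree G v ≤ Δ) (3k²Δ≤m : 3 * k ^ 2 * Δ ≤ m) where

  J = suc j

  instance
    k≢0 : NonZero k
    k≢0 = >-nonZero (≤-trans (s≤s z≤n) 3≤k)

  Δ≤m : Δ ≤ m
  Δ≤m = ≤-trans (m≤n*m Δ (3 * k ^ 2) {{m*n≢0 3 (k ^ 2) {{_}} {{m^n≢0 k 2}}}}) 3k²Δ≤m

  instance
    m≢0 : NonZero m
    m≢0 = >-nonZero (≤-trans (>-nonZero⁻¹ Δ) Δ≤m)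

  open Assignments k m
  open Exploration G
  open Counting k m G
  open BadCount k m G

  -- Large components and confined sequences each receive half of the allowance 1/J; the second half
  -- is shared among the sizes with weights 1/2, 1/4, and so on.
  bad-rare : ∀ ℓ → 6 * J * n ≤ 2 ^ ℓ →
    (4 * J * (k * suc g)) ^ (10 * (k * suc g)) * (n ^ 2 * Δ ^ (2 * g)) ≤ m ^ (k * suc g) →
    (4 * J * (k * (g + 29 * ℓ))) ^ (10 * (k * (2 + g))) ≤ m →
    J * badCount k m G ≤ totalCount k n m
  bad-rare ℓ ℓ-large hyp m-large = *-cancelˡ-≤ 2 (begin
    2 * (J * badCount k m G)
      ≡⟨ sym (*-assoc 2 J _) ⟩
    2 * J * badCount k m G
      ≤⟨ *-monoʳ-≤ (2 * J) (badCount-bound g r choosable) ⟩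
    2 * J * (∑ (allFin n) big + ∑ (upTo r) tight)
      ≡⟨ *-distribˡ-+ (2 * J) (∑ (allFin n) big) _ ⟩
    2 * J * ∑ (allFin n) big + 2 * J * ∑ (upTo r) tight
      ≤⟨ +-mono-≤ bigs tights ⟩
    T + T
      ≡⟨ cong (T +_) (sym (+-identityʳ T)) ⟩
    2 * T ∎)
    where
    open ≤-Reasoning
    r = 29 * ℓ
    T = totalCount k n m

    big : Fin n → ℕ
    big v = count (λ L → explore (conflict L) r [ v ] (edges v))

    tight : ℕ → ℕ
    tight t = ∑[ L ∈ assignments n ] confined ⌊ k * suc (g + t) /2⌋ (g + t) L

    bigs : 2 * J * ∑ (allFin n) big ≤ T
    bigs = *-cancelˡ-≤ n (begin
      n * (2 * J * ∑ (allFin n) big)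
        ≡⟨ sym (*-assoc n (2 * J) _) ⟩
      n * (2 * J) * ∑ (allFin n) big
        ≡⟨ sym (∑-*ˡ (n * (2 * J)) big (allFin n)) ⟩
      ∑[ v ∈ allFin n ] (n * (2 * J) * big v)
        ≤⟨ ∑-≤length (allFin n) (λ {v} _ → ≤-trans (≤-reflexive (*-assoc n (2 * J) (big v)))
             (large-component-rare J n ℓ (big v) T ℓ-large
               (explore-decay Δ r (big v) T (explore-count-from deg 3k²Δ≤m r v)))) ⟩
      length (allFin n) * T
        ≡⟨ cong (_* T) (length-tabulate {n = n} id) ⟩
      n * T ∎)

    tight-rare : ∀ t → t < r → 2 ^ suc t * (2 * J * tight t) ≤ T
    tight-rare t t<r = *-cancelˡ-≤ M {{m^n≢0 (m ^ k) (suc i) {{m^n≢0 m k}}}} (begin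
      M * (2 ^ suc t * (2 * J * tight t))
        ≡⟨ cong (M *_) (sym (*-assoc (2 ^ suc t) (2 * J) (tight t))) ⟩
      M * (W * tight t)
        ≡⟨ x∙yz≈y∙xz M W (tight t) ⟩
      W * (M * tight t)
        ≤⟨ *-monoʳ-≤ W (confined-count d i) ⟩
      W * (length (sequences i) * (suc m ^ d * ((d ^ k) ^ suc i * T)))
        ≤⟨ *-monoʳ-≤ W (*-monoˡ-≤ (suc m ^ d * ((d ^ k) ^ suc i * T)) (length-sequences deg i)) ⟩
      W * (n * (i * Δ) ^ i * (suc m ^ d * ((d ^ k) ^ suc i * T)))
        ≡⟨ regroup W (n * (i * Δ) ^ i) (suc m ^ d) ((d ^ k) ^ suc i) T ⟩
      W * (n * (i * Δ) ^ i * (suc m ^ d * (d ^ k) ^ suc i)) * T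
        ≤⟨ *-monoˡ-≤ T (weight-bound k J n m Δ i t d (m≤n+m t g) 2d≤
             (expected-sets k g J n m Δ r t 3≤k Δ≤m hyp m-large t<r)) ⟩
      m ^ (k * suc i) * T
        ≡⟨ cong (_* T) (sym (^-*-assoc m k (suc i))) ⟩
      M * T ∎)
      where
      i = g + t
      d = ⌊ k * suc i /2⌋
      M = (m ^ k) ^ suc i
      W = 2 ^ suc t * (2 * J)
      regroup : ∀ w l a b c → w * (l * (a * (b * c))) ≡ w * (l * (a * b)) * c
      regroup = solve-∀
      2d≤ : 2 * d ≤ k * suc i
      2d≤ = ≤-trans (+-monoʳ-≤ d (≤-trans (≤-reflexive (+-identityʳ d)) (⌊n/2⌋≤⌈n/2⌉ (k * suc i))))
        (≤-reflexive (⌊n/2⌋+⌈n/2⌉≡n (k * suc i)))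

    tights : 2 * J * ∑ (upTo r) tight ≤ T
    tights = ≤-trans (≤-reflexive (sym (∑-*ˡ (2 * J) tight (upTo r))))
      (geometric-∑ (λ t → 2 * J * tight t) id r tight-rare)

-- Passing to the limit along the sequence of graphs

⊆G-trans : ∀ {a b c} {A : Graph a} {B : Graph b} {C : Graph c} → A ⊆G B → B ⊆G C → A ⊆G C
⊆G-trans (f , f-inj , f-hom) (h , h-inj , h-hom) =
  h ∘ f , f-inj ∘ h-inj , λ u v → h-hom (f u) (f v) ∘ f-hom u v

degree≡0⇒edgeless : ∀ {n} (G : Graph n) → (∀ v → degree G v ≤ 0) → ∀ u v → adj G u v ≢ true
degree≡0⇒edgeless G deg u v uv = contradiction (deg u)
  (<⇒≱ (∈-length (∈-filter⁺ (λ w → adj G u w Bool.≟ true) (∈-allFin v) uv)))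

theorem2 : (k : ℕ) → 3 ≤ k → (ℋ : Family) → (g : ℕ) → IsG ℋ k g →
    (G : (n : ℕ) → Graph n) → (∀ n → (ℋ -free) (G n)) →
    (Δ : ℕ → ℕ) → (∀ n → MaxDegree (G n) (Δ n)) →
    (m : ℕ → ℕ) →
    (∀ C → ∃[ N ] ∀ n → N ≤ n → C * (n ^ 2 * Δ n ^ (2 * g)) ≤ m n ^ (k * suc g)) →
    (∀ n → 3 * k ^ 2 * Δ n ≤ m n) →
    (∀ j → ∃[ N ] ∀ n → N ≤ n →
      suc j * badCount k (m n) (G n) ≤ totalCount k n (m n))
theorem2 k 3≤k ℋ g (choosable , _) G free Δ max m m≫ 3k²Δ≤m j = 2 ^ ℓ₀ ⊔ N , bound
  where
  J = suc j
  e = k * suc g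
  -- `bad-rare` wants a polylogarithm bounded by m, but only n ≤ m^e is available, so the exponent
  -- is multiplied by `e`. The constant `c₀` below comes from g + 29ℓ ≤ (g + 29)ℓ for ℓ ≥ 1.
  α = 10 * (k * (2 + g)) * e
  c₀ = 4 * J * (k * (g + 29))
  C = (4 * J * (k * suc g)) ^ (10 * e)

  instance
    k≢0′ : NonZero k
    k≢0′ = >-nonZero (≤-trans (s≤s z≤n) 3≤k)
    e≢0 : NonZero e
    e≢0 = m*n≢0 k (suc g)
    C≢0 : NonZero C
    C≢0 = m^n≢0 (4 * J * e) (10 * e) {{m*n≢0 (4 * J) e}}

  -- The factor 12 J matches 2^ℓ ≤ 12 J n, where ℓ is a rounded logarithm of 6 J n; cancelling it
  -- leaves a bound by n. Requiring n ≥ 2^ℓ₀ forces ℓ ≥ ℓ₀.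
  ℓ₀ = proj₁ (2^-dominates α (12 * J * c₀ ^ α))
  N  = proj₁ (m≫ C)

  bound : ∀ n → 2 ^ ℓ₀ ⊔ N ≤ n → J * badCount k (m n) (G n) ≤ totalCount k n (m n)
  bound n large with Δ n | proj₁ (max n) | 3k²Δ≤m n | proj₂ (m≫ C) n (m⊔n≤o⇒n≤o (2 ^ ℓ₀) N large)
  ... | zero | deg | _ | _ = ≤-trans (≤-reflexive
    (trans (cong (J *_) (BadCount.edgeless⇒badCount≡0 k (m n) (G n) (degree≡0⇒edgeless (G n) deg))) (*-zeroʳ J))) z≤n
  ... | Δₙ@(suc _) | deg | mΔ | hyp = bad-rare ℓ ℓ-large hyp m-large
    where
    open ≤-Reasoning
    2^ℓ₀≤n : 2 ^ ℓ₀ ≤ n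
    2^ℓ₀≤n = m⊔n≤o⇒m≤o (2 ^ ℓ₀) N large

    instance
      n≢0 : NonZero n
      n≢0 = >-nonZero (≤-trans (m^n>0 2 ℓ₀) 2^ℓ₀≤n)
      6Jn≢0 : NonZero (6 * J * n)
      6Jn≢0 = m*n≢0 (6 * J) n

    open Instance k g j 3≤k (G n)
      (λ H h≤g H⊆G → choosable H h≤g (λ F F∈ℋ F⊆H → free n F F∈ℋ (⊆G-trans {A = F} {B = H} {C = G n} F⊆H H⊆G)))
      {Δₙ} {m n} deg mΔ using (bad-rare)

    bracket = log₂-bracket (pred (6 * J * n))
    ℓ = proj₁ bracket

    ℓ-large : 6 * J * n ≤ 2 ^ ℓ
    ℓ-large = subst (_≤ 2 ^ ℓ) (suc-pred (6 * J * n)) (proj₁ (proj₂ bracket))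

    2^ℓ≤ : 2 ^ ℓ ≤ 12 * J * n
    2^ℓ≤ = ≤-trans (subst (λ x → 2 ^ ℓ ≤ 2 * x) (suc-pred (6 * J * n)) (proj₂ (proj₂ bracket))) (≤-reflexive (twice J n))
      where
      twice : ∀ J n → 2 * (6 * J * n) ≡ 12 * J * n
      twice = solve-∀

    ℓ₀≤ℓ : ℓ₀ ≤ ℓ
    ℓ₀≤ℓ with ℓ₀ ≤? ℓ
    ... | yes ℓ₀≤ℓ = ℓ₀≤ℓ
    ... | no  ℓ₀≰ℓ = contradiction (≤-trans 2^ℓ₀≤n (≤-trans (m≤n*m n (6 * J)) ℓ-large))
      (<⇒≱ (^-monoʳ-< 2 (s≤s (s≤s z≤n)) (≰⇒> ℓ₀≰ℓ)))

    ℓ≢0 : NonZero ℓ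
    ℓ≢0 with ℓ | ℓ-large
    ... | suc _ | _    = _
    ... | zero  | 6≤1 = contradiction (≤-trans (m≤m*n 6 (J * n) {{m*n≢0 J n}}) (≤-trans (≤-reflexive (sym (*-assoc 6 J n))) 6≤1))
      (<⇒≱ (≤ᵇ⇒≤ 2 6 _))

    -- Δ may stay bounded, so the growth of m has to come from the hypothesis m ≫ ..., which makes m
    -- at least n^(1/e) and hence larger than any polylogarithm.
    n≤m^e : n ≤ m n ^ e
    n≤m^e = begin
      n                                  ≤⟨ m≤m*n n (n * 1 * Δₙ ^ (2 * g)) {{m*n≢0 (n * 1) (Δₙ ^ (2 * g)) {{m*n≢0 n 1}} {{m^n≢0 Δₙ (2 * g)}}}} ⟩
      n * (n * 1 * Δₙ ^ (2 * g))         ≡⟨ sym (*-assoc n (n * 1) _) ⟩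
      n ^ 2 * Δₙ ^ (2 * g)               ≤⟨ m≤n*m _ C ⟩
      C * (n ^ 2 * Δₙ ^ (2 * g))         ≤⟨ hyp ⟩
      m n ^ e                            ∎

    size≤ : 4 * J * (k * (g + 29 * ℓ)) ≤ c₀ * ℓ
    size≤ = begin
      4 * J * (k * (g + 29 * ℓ))      ≤⟨ *-monoʳ-≤ (4 * J) (*-monoʳ-≤ k (+-monoˡ-≤ (29 * ℓ) (m≤m*n g ℓ {{ℓ≢0}}))) ⟩
      4 * J * (k * (g * ℓ + 29 * ℓ))  ≡⟨ factor J k g ℓ ⟩
      c₀ * ℓ                          ∎
      where
      factor : ∀ J k g ℓ → 4 * J * (k * (g * ℓ + 29 * ℓ)) ≡ 4 * J * (k * (g + 29)) * ℓ
      factor = solve-∀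

    polylog≤n : (c₀ * ℓ) ^ α ≤ n
    polylog≤n = *-cancelˡ-≤ (12 * J) (begin
      12 * J * (c₀ * ℓ) ^ α        ≡⟨ cong (12 * J *_) (^-distribʳ-* α c₀ ℓ) ⟩
      12 * J * (c₀ ^ α * ℓ ^ α)    ≡⟨ sym (*-assoc (12 * J) (c₀ ^ α) (ℓ ^ α)) ⟩
      12 * J * c₀ ^ α * ℓ ^ α      ≤⟨ proj₂ (2^-dominates α (12 * J * c₀ ^ α)) ℓ ℓ₀≤ℓ ⟩
      2 ^ ℓ                        ≤⟨ 2^ℓ≤ ⟩
      12 * J * n                   ∎)

    m-large : (4 * J * (k * (g + 29 * ℓ))) ^ (10 * (k * (2 + g))) ≤ m n
    m-large = ^-cancelʳ-≤ e (begin
      ((4 * J * (k * (g + 29 * ℓ))) ^ (10 * (k * (2 + g)))) ^ e  ≡⟨ ^-*-assoc (4 * J * (k * (g + 29 * ℓ))) (10 * (k * (2 + g))) e ⟩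
      (4 * J * (k * (g + 29 * ℓ))) ^ α                           ≤⟨ ^-monoˡ-≤ α size≤ ⟩
      (c₀ * ℓ) ^ α                                               ≤⟨ polylog≤n ⟩
      n                                                          ≤⟨ n≤m^e ⟩
      m n ^ e                                                    ∎)
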